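{- Let $n$ be a positive integer. Any randomized (or deterministic) mechanism that decides SR solvability on instances with $n$ agents, using adaptive Boolean query access to the agents' preferences, requires $\Omega(n^2)$ Boolean queries in expectation. This bound holds even if queries may be made to fixed batches of agents of size up to $n/2$; that is, the agents are partitioned in advance, independently of the preferences, into batches each containing at most $n/2$ agents, and each query may be an arbitrary Boolean function of the preferences of the agents in a single batch.
   Context: An instance of the Stable Roommates problem (SR) consists of a finite set $S$ of agents together with, for each agent, a preference list that strictly ranks all other agents. Agent $a$ prefers $b$ to $c$ if $b$ appears before $c$ on $a$'s list. A matching is a partition of $S$ into pairs. Given a matching $M$, a pair $\{a,b\}\notin M$ is a blocking pair if $a$ prefers $b$ to its partner in $M$ and $b$ prefers $a$ to its partner in $M$. A matching with no blocking pair is stable. An instance is solvable if it admits a stable matching, and SR solvability is the problem of deciding whether a given instance is solvable. In the query model, the mechanism adaptively chooses Boolean queries, and later queries may depend on answers to earlier ones; a randomized mechanism must output the correct answer with bounded error (for example, with probability at least $2/3$) on every instance. The cost of a mechanism is the number of queries it makes.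
   Formalization: The bound is proved for even n only, since for odd n no matching exists and zero queries suffice; a randomized mechanism is a finitely supported distribution with rational probabilities over decision trees, correct with probability at least 2/3 on every instance. -}

module Defs where

open import Data.Bool using (Bool; true; false)
open import Data.Nat as ℕ using (ℕ; _*_)
open import Data.Fin using (Fin; _≟_)
open import Data.List using (List; []; _∷_; _++_; length; filter; allFin)
open import Data.List.Membership.Propositional using (_∈_)
open import Data.List.Relation.Unary.Unique.Propositional using (Unique)
open import Data.Product using (Σ; ∃; _×_; _,_; proj₁; proj₂)
open import Data.Integer using (+_)
open import Data.Rational as ℚ using (ℚ; 0ℚ; 1ℚ)
open import Function.Bundles using (_⇔_)
open import Relation.Nullary using (¬_)
open import Relation.Binary.PropositionalEquality using (_≡_; _≢_)

Profile : ℕ → Set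
Profile n = Fin n → List (Fin n)

ValidProfile : ∀ {n} → Profile n → Set
ValidProfile {n} P = ∀ (a : Fin n) → Unique (P a) × (∀ b → (b ∈ P a) ⇔ (b ≢ a))

Before : ∀ {n} → List (Fin n) → Fin n → Fin n → Set
Before {n} xs b c = Σ (List (Fin n)) λ ys → Σ (List (Fin n)) λ zs →
  (xs ≡ ys ++ (b ∷ zs)) × (c ∈ zs)

Prefers : ∀ {n} → Profile n → Fin n → Fin n → Fin n → Set
Prefers P a b c = Before (P a) b c

record Matching (n : ℕ) : Set where
  field
    partner    : Fin n → Fin n
    no-fixed   : ∀ a → partner a ≢ a
    involutive : ∀ a → partner (partner a) ≡ a
open Matching public

Blocking : ∀ {n} → Profile n → Matching n → Fin n → Fin n → Set
Blocking P M a b =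
  (a ≢ b) × (b ≢ partner M a) ×
  Prefers P a b (partner M a) × Prefers P b a (partner M b)

Stable : ∀ {n} → Profile n → Matching n → Set
Stable P M = ∀ a b → ¬ Blocking P M a b

Solvable : ∀ {n} → Profile n → Set
Solvable {n} P = ∃ λ (M : Matching n) → Stable P M

BatchSize : ∀ {n k} → (Fin n → Fin k) → Fin k → ℕ
BatchSize {n} batch i = length (filter (λ a → batch a ≟ i) (allFin n))

SmallBatches : ∀ {n k} → (Fin n → Fin k) → Set
SmallBatches {n} {k} batch = ∀ (i : Fin k) → 2 * BatchSize batch i ℕ.≤ n

AllowedQuery : ∀ {n k} → (Fin n → Fin k) → (Profile n → Bool) → Set
AllowedQuery {n} {k} batch q = Σ (Fin k) λ i →
  ∀ P Q → ValidProfile P → ValidProfile Q →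
    (∀ a → batch a ≡ i → P a ≡ Q a) → q P ≡ q Q

-- Deterministic adaptive query mechanisms = decision trees

data Tree (n : ℕ) : Set where
  leaf : Bool → Tree n
  node : (Profile n → Bool) → (ifFalse ifTrue : Tree n) → Tree n

data AllowedTree {n k} (batch : Fin n → Fin k) : Tree n → Set where
  leaf : ∀ b → AllowedTree batch (leaf b)
  node : ∀ {q l r} → AllowedQuery batch q →
         AllowedTree batch l → AllowedTree batch r →
         AllowedTree batch (node q l r)

output : ∀ {n} → Tree n → Profile n → Bool
output (leaf b) P = b
output (node q l r) P with q P
... | false = output l P
... | true  = output r P

cost : ∀ {n} → Tree n → Profile n → ℕ
cost (leaf b) P = 0
cost (node q l r) P with q P
... | false = ℕ.suc (cost l P)
... | true  = ℕ.suc (cost r P)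

-- Randomized mechanisms: finitely supported probability distributions
-- (rational weights) over deterministic decision trees.

sumℚ : List ℚ → ℚ
sumℚ [] = 0ℚ
sumℚ (x ∷ xs) = x ℚ.+ sumℚ xs

mapL : ∀ {A B : Set} → (A → B) → List A → List B
mapL f [] = []
mapL f (x ∷ xs) = f x ∷ mapL f xs

record Randomized (n : ℕ) : Set where
  field
    support : List (ℚ × Tree n)
    nonneg  : ∀ {w t} → (w , t) ∈ support → 0ℚ ℚ.≤ w
    total   : sumℚ (mapL proj₁ support) ≡ 1ℚ
open Randomized public

AllowedRandomized : ∀ {n k} → (Fin n → Fin k) → Randomized n → Set
AllowedRandomized batch R = ∀ {w t} → (w , t) ∈ support R → AllowedTree batch t

boolEq : Bool → Bool → Bool
boolEq true true = true
boolEq false false = true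
boolEq _ _ = false

probOutput : ∀ {n} → Randomized n → Profile n → Bool → ℚ
probOutput R P b =
  sumℚ (mapL (λ wt → if′ boolEq (output (proj₂ wt) P) b then proj₁ wt else 0ℚ) (support R))
  where
  if′_then_else_ : Bool → ℚ → ℚ → ℚ
  if′ true  then x else y = x
  if′ false then x else y = y

expectedCost : ∀ {n} → Randomized n → Profile n → ℚ
expectedCost R P =
  sumℚ (mapL (λ wt → proj₁ wt ℚ.* ((+ cost (proj₂ wt) P) ℚ./ 1)) (support R))

DecidesSolvability : ∀ {n} → Randomized n → Set
DecidesSolvability {n} R =
  ∀ (P : Profile n) → ValidProfile P →
  ∀ (b : Bool) → (b ≡ true ⇔ Solvable P) →
  ((+ 2) ℚ./ 3) ℚ.≤ probOutput R P b

{-# OPTIONS --safe #-}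

-- Merging batches splits the agents into two sides of at least n/4 agents each, so a mechanism is a two-party
-- protocol. Alice's agents hold an m × m bit matrix x and Bob's agents a matrix y, with m linear in n: alice i prefers
-- bob j to her mate iff x i j = 1, and bob j prefers alice i to his iff y i j = 1. If x and y are disjoint, pairing
-- everybody with their mate is stable. If they meet in exactly one entry (i, j), then alice i and bob j must elope, and
-- alice's abandoned mate forms an odd party with the two hub agents, so no stable matching exists.
--
-- Disjointness on N = m² bits needs a linear number of bits, by a corruption bound. Give each coordinate to Alice or
-- Bob at random (the set D), and let the owner's bit be uniform and the other's 0. For a rectangle α × β let aᵢ𝒸 and
-- bᵢ𝒸 be the conditional acceptance probabilities given that bit i is c. The sum over i in D of (aᵢ₀ - aᵢ₁)⁺ is the
-- correlation of α with a sum of independent signs, hence at most 2(k a + η), with k = N/40 and η exponentially small.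
-- Together with a₀b₀ ≤ a₁b₁ + (a₀ - a₁)⁺b₀ + (b₀ - b₁)⁺a₀ this shows that planting a common 1 instead of a common 0 in a
-- random coordinate lowers the acceptance probability of a protocol with K queries by at most 1/5 plus a term of order 2^K η.
module Submission where

open import Defs
open import Data.Bool using (Bool; true; false; not; _∧_; if_then_else_)
import Data.Bool.Properties as Bool
open import Data.Empty using (⊥; ⊥-elim)
open import Data.Fin as Fin using (Fin; zero; suc; toℕ; cast; splitAt; join; combine; remQuot; _↑ˡ_; _↑ʳ_)
import Data.Fin.Properties as Fin
open import Data.Integer as ℤ using ()
import Data.Integer.Properties as ℤ
open import Data.List using (List; []; _∷_; _++_; length; filter; allFin; lookup)
open import Data.List.Membership.Propositional using (_∈_)
open import Data.List.Membership.Propositional.Properties using (∈-allFin; ∈-filter⁺; ∈-filter⁻; ∈-++⁻; ∈-++⁺ˡ; ∈-++⁺ʳ; ∈-∃++; ∈-lookup)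
open import Data.List.Properties using (length-++; length-tabulate; filter-all; filter-none)
open import Data.List.Relation.Binary.Permutation.Propositional using (↭-sym; ↭⇒↭ₛ)
open import Data.List.Relation.Binary.Permutation.Propositional.Properties using (∈-resp-↭)
import Data.List.Relation.Binary.Permutation.Setoid.Properties as Perm
open import Data.List.Relation.Unary.All as All using (All; []; _∷_)
import Data.List.Relation.Unary.All.Properties as All
open import Data.List.Relation.Unary.AllPairs using (AllPairs; []; _∷_)
open import Data.List.Relation.Unary.Any using (here; there; index)
open import Data.List.Relation.Unary.Any.Properties using (lookup-index)
open import Data.List.Relation.Unary.Sorted.TotalOrder.Properties using (Sorted⇒AllPairs)
open import Data.List.Relation.Unary.Unique.Propositional using (Unique)
import Data.List.Relation.Unary.Unique.Propositional.Properties as Unique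
import Data.List.Sort
open import Data.Nat as ℕ using (ℕ; zero; suc)
open import Data.Nat.Coprimality as Coprime using (1-coprimeTo)
open import Data.Nat.Divisibility using (_∣_; divides)
open import Data.Nat.DivMod using (m/n*n≤m; m≡m%n+[m/n]*n; m%n<n; m≥n⇒m/n>0)
import Data.Nat.Properties as ℕ
open import Data.Nat.Solver using () renaming (module +-*-Solver to ℕ-Solver)
open import Data.Product using (Σ; ∃; _×_; _,_; proj₁; proj₂)
open import Data.Product.Properties using (≡-dec)
open import Data.Rational as ℚ using ()
import Data.Rational.Properties as ℚ
open import Data.Rational.Solver using () renaming (module +-*-Solver to ℚ-Solver)
open import Data.Sum as Sum using (_⊎_; inj₁; inj₂; [_,_]′)
import Data.Sum.Properties as Sum
open import Data.Vec as Vec using (Vec; []; _∷_; _[_]≔_)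
open import Data.Vec.Properties using (lookup-map; lookup-zipWith; lookup∘tabulate; lookup∘updateAt; lookup∘update; lookup∘update′; map-[]≔; map-∘; map-id; map-cong)
open import Function using (_∘_)
open import Function.Bundles using (mk⇔)
open import Relation.Binary using (DecidableEquality; DecTotalOrder)
import Relation.Binary.Construct.On as On
open import Relation.Binary.PropositionalEquality
open import Relation.Nullary using (¬_; ¬?; Dec; yes; no; does; contradiction)
open import Relation.Nullary.Decidable as Dec using (toWitness; toWitnessFalse; map′; dec-true; dec-false; _⊎-dec_)
open import Relation.Unary using (Decidable)

-- Rational inequalities, positive linear functionals and averages over bit vectors.

module Disjointness where
  open import Data.Rational
  open import Data.Rational.Properties
  open ℚ-Solver

  p+x≤q⇒p≤q : ∀ {p x q} → p + x ≤ q → 0ℚ ≤ x → p ≤ q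
  p+x≤q⇒p≤q {p} {x} p+x≤q 0≤x =
    ≤-trans (≤-trans (≤-reflexive (sym (+-identityʳ p))) (+-monoʳ-≤ p 0≤x)) p+x≤q

  *-monoˡ-≤ : ∀ {r p q} → 0ℚ ≤ r → p ≤ q → r * p ≤ r * q
  *-monoˡ-≤ {r} 0≤r = *-monoˡ-≤-nonNeg r {{nonNegative 0≤r}}

  *-monoʳ-≤ : ∀ {r p q} → 0ℚ ≤ r → p ≤ q → p * r ≤ q * r
  *-monoʳ-≤ {r} 0≤r = *-monoʳ-≤-nonNeg r {{nonNegative 0≤r}}

  0≤p+q : ∀ {p q} → 0ℚ ≤ p → 0ℚ ≤ q → 0ℚ ≤ p + q
  0≤p+q = +-mono-≤

  0≤p*q : ∀ {p q} → 0ℚ ≤ p → 0ℚ ≤ q → 0ℚ ≤ p * q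
  0≤p*q {p} {q} 0≤p 0≤q = ≤-trans (≤-reflexive (sym (*-zeroʳ p))) (*-monoˡ-≤ 0≤p 0≤q)

  -- Uniform averages, sums over coordinates and their iterated products are all instances, so
  -- linearity is used uniformly. Antisymmetry derives `ext` from `mono`, which lets pointwise equal
  -- integrands replace each other.
  record PositiveLinear {X : Set} (Φ : (X → ℚ) → ℚ) : Set where
    field
      mono  : ∀ {f g} → (∀ x → f x ≤ g x) → Φ f ≤ Φ g
      add   : ∀ f g → Φ (λ x → f x + g x) ≡ Φ f + Φ g
      scale : ∀ c f → Φ (λ x → c * f x) ≡ c * Φ f

    ext : ∀ {f g} → (∀ x → f x ≡ g x) → Φ f ≡ Φ g
    ext f≡g = ≤-antisym (mono (≤-reflexive ∘ f≡g)) (mono (≤-reflexive ∘ sym ∘ f≡g))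

    vanish : Φ (λ _ → 0ℚ) ≡ 0ℚ
    vanish = trans (ext (λ _ → sym (*-zeroˡ 0ℚ))) (trans (scale 0ℚ (λ _ → 0ℚ)) (*-zeroˡ (Φ (λ _ → 0ℚ))))

    preserves-≥0 : ∀ {f} → (∀ x → 0ℚ ≤ f x) → 0ℚ ≤ Φ f
    preserves-≥0 0≤f = ≤-trans (≤-reflexive (sym vanish)) (mono 0≤f)

  𝔼 : ∀ {N} → (Vec Bool N → ℚ) → ℚ
  𝔼 {zero}  f = f []
  𝔼 {suc N} f = ½ * (𝔼 (λ v → f (false ∷ v)) + 𝔼 (λ v → f (true ∷ v)))

  sumF : ∀ {N} → (Fin N → ℚ) → ℚ
  sumF {zero}  f = 0ℚ
  sumF {suc N} f = f zero + sumF (f ∘ suc)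

  0≤½ : 0ℚ ≤ ½
  0≤½ = nonNegative⁻¹ ½

  open PositiveLinear public

  𝔼-linear : ∀ {N} → PositiveLinear (𝔼 {N})
  𝔼-linear {zero} = record { mono = λ p → p [] ; add = λ _ _ → refl ; scale = λ _ _ → refl }
  𝔼-linear {suc N} = record
    { mono  = λ p → *-monoˡ-≤ 0≤½ (+-mono-≤ (mono rec (λ v → p (false ∷ v))) (mono rec (λ v → p (true ∷ v))))
    ; add   = λ f g → trans (cong (½ *_) (cong₂ _+_ (add rec _ _) (add rec _ _)))
        (solve 4 (λ a b c d → con ½ :* ((a :+ b) :+ (c :+ d)) := con ½ :* (a :+ c) :+ con ½ :* (b :+ d)) refl
           (𝔼 (λ v → f (false ∷ v))) (𝔼 (λ v → g (false ∷ v))) (𝔼 (λ v → f (true ∷ v))) (𝔼 (λ v → g (true ∷ v))))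
    ; scale = λ c f → trans (cong (½ *_) (cong₂ _+_ (scale rec c _) (scale rec c _)))
        (solve 3 (λ c a b → con ½ :* (c :* a :+ c :* b) := c :* (con ½ :* (a :+ b))) refl
           c (𝔼 (λ v → f (false ∷ v))) (𝔼 (λ v → f (true ∷ v))))
    }
    where rec = 𝔼-linear {N}

  sumF-linear : ∀ {N} → PositiveLinear (sumF {N})
  sumF-linear {zero} = record { mono = λ _ → ≤-refl ; add = λ _ _ → refl ; scale = λ c _ → sym (*-zeroʳ c) }
  sumF-linear {suc N} = record
    { mono  = λ p → +-mono-≤ (p zero) (mono rec (p ∘ suc))
    ; add   = λ f g → trans (cong (f zero + g zero +_) (add rec _ _))
        (solve 4 (λ a b c d → (a :+ b) :+ (c :+ d) := (a :+ c) :+ (b :+ d)) refl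
           (f zero) (g zero) (sumF (f ∘ suc)) (sumF (g ∘ suc)))
    ; scale = λ c f → trans (cong (c * f zero +_) (scale rec c _)) (sym (*-distribˡ-+ c (f zero) (sumF (f ∘ suc))))
    }
    where rec = sumF-linear {N}

  _⊗_ : ∀ {X Y : Set} → ((X → ℚ) → ℚ) → ((Y → ℚ) → ℚ) → (X × Y → ℚ) → ℚ
  (Φ ⊗ Ψ) f = Φ (λ x → Ψ (λ y → f (x , y)))

  infixr 4 _⊗_

  ⊗-linear : ∀ {X Y : Set} {Φ : (X → ℚ) → ℚ} {Ψ : (Y → ℚ) → ℚ} →
             PositiveLinear Φ → PositiveLinear Ψ → PositiveLinear (Φ ⊗ Ψ)
  ⊗-linear Φ Ψ = record
    { mono  = λ p → mono Φ (λ x → mono Ψ (λ y → p (x , y)))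
    ; add   = λ f g → trans (ext Φ (λ x → add Ψ _ _)) (add Φ _ _)
    ; scale = λ c f → trans (ext Φ (λ x → scale Ψ c _)) (scale Φ c _)
    }

  pullback-linear : ∀ {X Y : Set} {Φ : (X → ℚ) → ℚ} (h : X → Y) →
                    PositiveLinear Φ → PositiveLinear (λ f → Φ (f ∘ h))
  pullback-linear h Φ = record
    { mono  = λ p → mono Φ (p ∘ h)
    ; add   = λ f g → add Φ (f ∘ h) (g ∘ h)
    ; scale = λ c f → scale Φ c (f ∘ h)
    }

  scaleʳ : ∀ {X : Set} {Φ : (X → ℚ) → ℚ} → PositiveLinear Φ → ∀ f c → Φ (λ x → f x * c) ≡ Φ f * c
  scaleʳ {Φ = Φ} lin f c =
    trans (ext lin (λ x → *-comm (f x) c)) (trans (scale lin c f) (*-comm c (Φ f)))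

  𝔼-const : ∀ N c → 𝔼 {N} (λ _ → c) ≡ c
  𝔼-const zero    c = refl
  𝔼-const (suc N) c = trans (cong₂ (λ p q → ½ * (p + q)) (𝔼-const N c) (𝔼-const N c))
    (solve 1 (λ c → con ½ :* (c :+ c) := c) refl c)

  𝔼≤ : ∀ {N c} {f : Vec Bool N → ℚ} → (∀ v → f v ≤ c) → 𝔼 f ≤ c
  𝔼≤ {N} {c} f≤c = ≤-trans (mono 𝔼-linear f≤c) (≤-reflexive (𝔼-const N c))

  𝔼-product : ∀ {M N} (f : Vec Bool M → ℚ) (g : Vec Bool N → ℚ) →
              𝔼 (λ u → 𝔼 (λ v → f u * g v)) ≡ 𝔼 f * 𝔼 g
  𝔼-product f g = trans (ext 𝔼-linear (λ u → scale 𝔼-linear (f u) g)) (scaleʳ 𝔼-linear f (𝔼 g))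

  -- Fubini: `𝔼` is built from binary sums and a factor `½`, and both commute with any linear
  -- functional.
  𝔼-swap : ∀ {N} {X : Set} {Φ : (X → ℚ) → ℚ} → PositiveLinear Φ → (f : X → Vec Bool N → ℚ) →
           Φ (λ x → 𝔼 (f x)) ≡ 𝔼 (λ v → Φ (λ x → f x v))
  𝔼-swap {zero}  lin f = refl
  𝔼-swap {suc N} lin f = trans (scale lin ½ _) (cong (½ *_) (trans (add lin _ _)
    (cong₂ _+_ (𝔼-swap lin (λ x v → f x (false ∷ v))) (𝔼-swap lin (λ x v → f x (true ∷ v))))))

  -- Bit i of a uniform vector is a fair coin independent of the other bits. This gives access to
  -- conditioning on a single bit.
  𝔼-resample : ∀ {N} (i : Fin N) (f : Vec Bool N → ℚ) →
               𝔼 f ≡ ½ * (𝔼 (λ v → f (v [ i ]≔ false)) + 𝔼 (λ v → f (v [ i ]≔ true)))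
  𝔼-resample zero f =
    solve 2 (λ a b → con ½ :* (a :+ b) := con ½ :* ((con ½ :* (a :+ a)) :+ con ½ :* (b :+ b))) refl
      (𝔼 (λ v → f (false ∷ v))) (𝔼 (λ v → f (true ∷ v)))
  𝔼-resample (suc i) f =
    trans (cong₂ (λ p q → ½ * (p + q)) (𝔼-resample i (λ v → f (false ∷ v))) (𝔼-resample i (λ v → f (true ∷ v))))
    (solve 4 (λ a b c d → con ½ :* ((con ½ :* (a :+ b)) :+ con ½ :* (c :+ d))
         := con ½ :* ((con ½ :* (a :+ c)) :+ con ½ :* (b :+ d))) refl
      (𝔼 (λ v → f (false ∷ v [ i ]≔ false))) (𝔼 (λ v → f (false ∷ v [ i ]≔ true)))
      (𝔼 (λ v → f (true ∷ v [ i ]≔ false))) (𝔼 (λ v → f (true ∷ v [ i ]≔ true))))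

  -- The two halves of the recursion trade places. This symmetry later exchanges Alice and Bob.
  𝔼-complement : ∀ {N} (f : Vec Bool N → ℚ) → 𝔼 f ≡ 𝔼 (λ v → f (Vec.map not v))
  𝔼-complement {zero}  f = refl
  𝔼-complement {suc N} f =
    trans (cong₂ (λ p q → ½ * (p + q)) (𝔼-complement (λ v → f (false ∷ v))) (𝔼-complement (λ v → f (true ∷ v))))
          (cong (½ *_) (+-comm (𝔼 (λ v → f (false ∷ Vec.map not v))) (𝔼 (λ v → f (true ∷ Vec.map not v)))))

  -- Indicators, natural numbers and powers in ℚ.

  ind : Bool → ℚ
  ind true  = 1ℚ
  ind false = 0ℚ

  0≤ind : ∀ b → 0ℚ ≤ ind b
  0≤ind true  = nonNegative⁻¹ 1ℚ
  0≤ind false = ≤-refl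

  ind≤1 : ∀ b → ind b ≤ 1ℚ
  ind≤1 true  = ≤-refl
  ind≤1 false = nonNegative⁻¹ 1ℚ

  -- Recursive, so that inductions on the number compute; `ι≡/1` links it to the fractions in
  -- `expectedCost`.
  ι : ℕ → ℚ
  ι zero    = 0ℚ
  ι (suc n) = 1ℚ + ι n

  0≤ι : ∀ n → 0ℚ ≤ ι n
  0≤ι zero    = ≤-refl
  0≤ι (suc n) = 0≤p+q (nonNegative⁻¹ 1ℚ) (0≤ι n)

  ι-mono : ∀ {m n} → m ℕ.≤ n → ι m ≤ ι n
  ι-mono {n = n} ℕ.z≤n = 0≤ι n
  ι-mono (ℕ.s≤s m≤n)   = +-monoʳ-≤ 1ℚ (ι-mono m≤n)

  ι≡/1 : ∀ n → ι n ≡ ℤ.+ n / 1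
  ι≡/1 zero    = refl
  ι≡/1 (suc n) = trans (cong (1ℚ +_) (trans (ι≡/1 n) (normalize-coprime (Coprime.sym (1-coprimeTo n)))))
    (cong (_/ 1) (cong (λ i → ℤ.1ℤ ℤ.+ i) (ℤ.*-identityʳ (ℤ.+ n))))

  ι-+ : ∀ m n → ι (m ℕ.+ n) ≡ ι m + ι n
  ι-+ zero    n = sym (+-identityˡ (ι n))
  ι-+ (suc m) n = trans (cong (1ℚ +_) (ι-+ m n)) (sym (+-assoc 1ℚ (ι m) (ι n)))

  ι-* : ∀ m n → ι (m ℕ.* n) ≡ ι m * ι n
  ι-* zero    n = sym (*-zeroˡ (ι n))
  ι-* (suc m) n = trans (ι-+ n (m ℕ.* n)) (trans (cong (ι n +_) (ι-* m n))
    (solve 2 (λ m n → n :+ m :* n := (con 1ℚ :+ m) :* n) refl (ι m) (ι n)))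

  infixr 8 _^_

  _^_ : ℚ → ℕ → ℚ
  p ^ zero  = 1ℚ
  p ^ suc n = p * p ^ n

  0≤^ : ∀ {p} → 0ℚ ≤ p → ∀ n → 0ℚ ≤ p ^ n
  0≤^ 0≤p zero    = nonNegative⁻¹ 1ℚ
  0≤^ 0≤p (suc n) = 0≤p*q 0≤p (0≤^ 0≤p n)

  -- Exponential tail bound for sums of independent signs.

  -- cosh = (r + r⁻¹) / 2.
  r r⁻¹ cosh 40ℚ : ℚ
  r    = ℤ.+ 41 / 40
  r⁻¹  = ℤ.+ 40 / 41
  cosh = ℤ.+ 3281 / 3280
  40ℚ  = ℤ.+ 40 / 1

  0≤r : 0ℚ ≤ r
  0≤r = nonNegative⁻¹ r

  0≤r⁻¹ : 0ℚ ≤ r⁻¹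
  0≤r⁻¹ = nonNegative⁻¹ r⁻¹

  1≤r : 1ℚ ≤ r
  1≤r = toWitness {a? = 1ℚ ≤? r} _

  1≤r^ : ∀ j → 1ℚ ≤ r ^ j
  1≤r^ zero    = ≤-refl
  1≤r^ (suc j) = ≤-trans (1≤r^ j) (≤-trans (≤-reflexive (sym (*-identityˡ (r ^ j))))
    (*-monoʳ-≤ (0≤^ 0≤r j) 1≤r))

  -- Since `r` is 1 + 1/40, each step raises the right side by `r ^ j`, which is at least 1.
  bernoulli : ∀ j → ι j ≤ 40ℚ * r ^ j
  bernoulli zero    = nonNegative⁻¹ _
  bernoulli (suc j) = ≤-trans (+-mono-≤ (1≤r^ j) (bernoulli j))
    (≤-reflexive (solve 1 (λ x → x :+ con 40ℚ :* x := con 40ℚ :* (con r :* x)) refl (r ^ j)))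

  -- This is `bernoulli` for the exponent j - k, written without subtraction: j and k are lowered
  -- together until one of them is 0.
  exponential-dominates : ∀ j k → ι j ≤ ι k + 40ℚ * (r ^ j * r⁻¹ ^ k)
  exponential-dominates zero k = 0≤p+q (0≤ι k) (0≤p*q (nonNegative⁻¹ 40ℚ) (0≤p*q (nonNegative⁻¹ 1ℚ) (0≤^ 0≤r⁻¹ k)))
  exponential-dominates (suc j) zero = ≤-trans (bernoulli (suc j))
    (≤-reflexive (solve 1 (λ x → con 40ℚ :* x := con 0ℚ :+ con 40ℚ :* (x :* con 1ℚ)) refl (r ^ suc j)))
  exponential-dominates (suc j) (suc k) = ≤-trans (+-monoʳ-≤ 1ℚ (exponential-dominates j k))
    (≤-reflexive (solve 3 (λ c x y → con 1ℚ :+ (c :+ con 40ℚ :* (x :* y))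
        := (con 1ℚ :+ c) :+ con 40ℚ :* ((con r :* x) :* (con r⁻¹ :* y))) refl (ι k) (r ^ j) (r⁻¹ ^ k)))

  sgn : Bool → ℚ
  sgn false = 1ℚ
  sgn true  = - 1ℚ

  deviation : ∀ {N} → Vec Bool N → Vec Bool N → ℚ
  deviation τ z = sumF (λ i → ind (Vec.lookup τ i) * sgn (Vec.lookup z i))

  factor : Bool → Bool → ℚ
  factor false _     = 1ℚ
  factor true  false = r
  factor true  true  = r⁻¹

  -- The power of `r` with exponent `deviation τ z`, as a product over the bits.
  weight : ∀ {N} → Vec Bool N → Vec Bool N → ℚ
  weight []      []      = 1ℚ
  weight (t ∷ τ) (b ∷ z) = factor t b * weight τ z

  0≤weight : ∀ {N} (τ z : Vec Bool N) → 0ℚ ≤ weight τ z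
  0≤weight []      []      = nonNegative⁻¹ 1ℚ
  0≤weight (false ∷ τ) (b ∷ z) = 0≤p*q (nonNegative⁻¹ 1ℚ) (0≤weight τ z)
  0≤weight (true ∷ τ) (false ∷ z) = 0≤p*q 0≤r (0≤weight τ z)
  0≤weight (true ∷ τ) (true ∷ z) = 0≤p*q 0≤r⁻¹ (0≤weight τ z)

  -- The accumulators absorb the signs one at a time: a sign +1 raises j and a sign -1 raises k, so
  -- all exponents stay natural. The empty walk is `exponential-dominates`.
  deviation-bound : ∀ {N} (τ z : Vec Bool N) j k →
                    ι j + deviation τ z ≤ ι k + 40ℚ * (r ^ j * (weight τ z * r⁻¹ ^ k))
  deviation-bound [] [] j k = ≤-trans (≤-reflexive (+-identityʳ (ι j))) (≤-trans (exponential-dominates j k)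
    (≤-reflexive (solve 3 (λ c x y → c :+ con 40ℚ :* (x :* y) := c :+ con 40ℚ :* (x :* (con 1ℚ :* y)))
       refl (ι k) (r ^ j) (r⁻¹ ^ k))))
  deviation-bound (false ∷ τ) (b ∷ z) j k = ≤-trans
    (≤-reflexive (solve 3 (λ j s d → j :+ (con 0ℚ :* s :+ d) := j :+ d) refl (ι j) (sgn b) (deviation τ z)))
    (≤-trans (deviation-bound τ z j k)
    (≤-reflexive (solve 4 (λ c x w y → c :+ con 40ℚ :* (x :* (w :* y)) := c :+ con 40ℚ :* (x :* ((con 1ℚ :* w) :* y)))
       refl (ι k) (r ^ j) (weight τ z) (r⁻¹ ^ k))))
  deviation-bound (true ∷ τ) (false ∷ z) j k = ≤-trans
    (≤-reflexive (solve 2 (λ j d → j :+ (con 1ℚ :* con 1ℚ :+ d) := (con 1ℚ :+ j) :+ d) refl (ι j) (deviation τ z)))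
    (≤-trans (deviation-bound τ z (suc j) k)
    (≤-reflexive (solve 4 (λ c x w y → c :+ con 40ℚ :* ((con r :* x) :* (w :* y)) := c :+ con 40ℚ :* (x :* ((con r :* w) :* y)))
       refl (ι k) (r ^ j) (weight τ z) (r⁻¹ ^ k))))
  deviation-bound (true ∷ τ) (true ∷ z) j k = ≤-trans
    (≤-reflexive (solve 2 (λ j d → j :+ (con 1ℚ :* con (- 1ℚ) :+ d) := con (- 1ℚ) :+ (j :+ d)) refl (ι j) (deviation τ z)))
    (≤-trans (+-monoʳ-≤ (- 1ℚ) (deviation-bound τ z j (suc k)))
    (≤-reflexive (solve 4 (λ c x w y → con (- 1ℚ) :+ ((con 1ℚ :+ c) :+ con 40ℚ :* (x :* (w :* (con r⁻¹ :* y))))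
          := c :+ con 40ℚ :* (x :* ((con r⁻¹ :* w) :* y)))
       refl (ι k) (r ^ j) (weight τ z) (r⁻¹ ^ k))))

  -- The moment generating function factorises over independent bits. A selected bit contributes
  -- `cosh`, any other bit 1, which is no larger.
  𝔼-weight : ∀ {N} (τ : Vec Bool N) → 𝔼 (weight τ) ≤ cosh ^ N
  𝔼-weight [] = ≤-refl
  𝔼-weight {suc N} (t ∷ τ) = ≤-trans
    (≤-reflexive (trans (cong₂ (λ p q → ½ * (p + q)) (scale 𝔼-linear (factor t false) (weight τ)) (scale 𝔼-linear (factor t true) (weight τ)))
      (solve 3 (λ a b e → con ½ :* (a :* e :+ b :* e) := (con ½ :* (a :+ b)) :* e) refl
         (factor t false) (factor t true) (𝔼 (weight τ)))))
    (≤-trans (*-monoʳ-≤ (preserves-≥0 𝔼-linear (0≤weight τ)) (avg t))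
             (*-monoˡ-≤ (nonNegative⁻¹ cosh) (𝔼-weight τ)))
    where
    avg : ∀ t → ½ * (factor t false + factor t true) ≤ cosh
    avg true  = ≤-refl
    avg false = toWitness {a? = 1ℚ ≤? cosh} _

  -- Positive parts and the corruption inequality at one coordinate.

  2ℚ 4ℚ 8ℚ : ℚ
  2ℚ = ℤ.+ 2 / 1
  4ℚ = ℤ.+ 4 / 1
  8ℚ = ℤ.+ 8 / 1

  isInj₁ : ∀ {A B : Set} → A ⊎ B → Bool
  isInj₁ (inj₁ _) = true
  isInj₁ (inj₂ _) = false

  -- Opaque, so that the comparison never unfolds to its decision procedure; proofs inspect it only
  -- through `≥ᵇ-view`.
  opaque
    _≥ᵇ_ : ℚ → ℚ → Bool
    p ≥ᵇ q = isInj₁ (≤-total q p)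

    ≥ᵇ-view : ∀ p q → (q ≤ p × p ≥ᵇ q ≡ true) ⊎ (p ≤ q × p ≥ᵇ q ≡ false)
    ≥ᵇ-view p q = view (≤-total q p)
      where
      view : (t : q ≤ p ⊎ p ≤ q) → (q ≤ p × isInj₁ t ≡ true) ⊎ (p ≤ q × isInj₁ t ≡ false)
      view (inj₁ q≤p) = inj₁ (q≤p , refl)
      view (inj₂ p≤q) = inj₂ (p≤q , refl)

  -- The positive part of p - q, split into a bit and a linear term: the bit becomes an entry of
  -- `rising`, the linear term a correlation with a sign.
  excess : ℚ → ℚ → ℚ
  excess p q = ind (p ≥ᵇ q) * (p - q)

  0≤q-p : ∀ {p q} → p ≤ q → 0ℚ ≤ q - p
  0≤q-p {p} {q} p≤q = ≤-trans (≤-reflexive (sym (+-inverseʳ p))) (+-monoˡ-≤ (- p) p≤q)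

  0≤excess : ∀ p q → 0ℚ ≤ excess p q
  0≤excess p q with ≥ᵇ-view p q
  ... | inj₁ (q≤p , eq) rewrite eq = 0≤p*q (0≤ind true) (0≤q-p q≤p)
  ... | inj₂ (_ , eq)   rewrite eq = ≤-reflexive (sym (*-zeroˡ (p - q)))

  p≤q+excess : ∀ p q → p ≤ q + excess p q
  p≤q+excess p q with ≥ᵇ-view p q
  ... | inj₁ (_ , eq) rewrite eq = ≤-reflexive (solve 2 (λ p q → p := q :+ con 1ℚ :* (p :- q)) refl p q)
  ... | inj₂ (p≤q , eq) rewrite eq = ≤-trans p≤q (≤-reflexive (solve 2 (λ p q → q := q :+ con 0ℚ :* (p :- q)) refl p q))

  -- The excess of b is charged to a₀ alone, never to a₁: only a₀-weighted excesses can be averaged later on.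
  product-excess : ∀ {a₀ a₁ b₀ b₁} → 0ℚ ≤ a₀ → 0ℚ ≤ a₁ → 0ℚ ≤ b₀ → 0ℚ ≤ b₁ →
                   a₀ * b₀ ≤ a₁ * b₁ + (excess a₀ a₁ * b₀ + excess b₀ b₁ * a₀)
  product-excess {a₀} {a₁} {b₀} {b₁} 0≤a₀ 0≤a₁ 0≤b₀ 0≤b₁ with ≥ᵇ-view a₀ a₁
  ... | inj₁ (a₁≤a₀ , eq) rewrite eq = begin
    a₀ * b₀
      ≡⟨ solve 3 (λ a₀ a₁ b₀ → a₀ :* b₀ := a₁ :* b₀ :+ con 1ℚ :* (a₀ :- a₁) :* b₀) refl a₀ a₁ b₀ ⟩
    a₁ * b₀ + 1ℚ * (a₀ - a₁) * b₀
      ≤⟨ +-monoˡ-≤ (1ℚ * (a₀ - a₁) * b₀) (*-monoˡ-≤ 0≤a₁ (p≤q+excess b₀ b₁)) ⟩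
    a₁ * (b₁ + e) + 1ℚ * (a₀ - a₁) * b₀
      ≡⟨ solve 5 (λ a₀ a₁ b₀ b₁ e → a₁ :* (b₁ :+ e) :+ con 1ℚ :* (a₀ :- a₁) :* b₀
           := a₁ :* b₁ :+ (con 1ℚ :* (a₀ :- a₁) :* b₀ :+ e :* a₁)) refl a₀ a₁ b₀ b₁ e ⟩
    a₁ * b₁ + (1ℚ * (a₀ - a₁) * b₀ + e * a₁)
      ≤⟨ +-monoʳ-≤ (a₁ * b₁) (+-monoʳ-≤ (1ℚ * (a₀ - a₁) * b₀) (*-monoˡ-≤ (0≤excess b₀ b₁) a₁≤a₀)) ⟩
    a₁ * b₁ + (1ℚ * (a₀ - a₁) * b₀ + e * a₀) ∎
    where open ≤-Reasoning
          e = excess b₀ b₁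
  ... | inj₂ (a₀≤a₁ , eq) rewrite eq = begin
    a₀ * b₀
      ≤⟨ *-monoˡ-≤ 0≤a₀ (p≤q+excess b₀ b₁) ⟩
    a₀ * (b₁ + e)
      ≡⟨ *-distribˡ-+ a₀ b₁ e ⟩
    a₀ * b₁ + a₀ * e
      ≤⟨ +-monoˡ-≤ (a₀ * e) (*-monoʳ-≤ 0≤b₁ a₀≤a₁) ⟩
    a₁ * b₁ + a₀ * e
      ≡⟨ solve 5 (λ a₀ a₁ b₀ b₁ e → a₁ :* b₁ :+ a₀ :* e
           := a₁ :* b₁ :+ (con 0ℚ :* (a₀ :- a₁) :* b₀ :+ e :* a₀)) refl a₀ a₁ b₀ b₁ e ⟩
    a₁ * b₁ + (0ℚ * (a₀ - a₁) * b₀ + e * a₀) ∎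
    where open ≤-Reasoning
          e = excess b₀ b₁

  -- Averages and conditional averages over masked inputs.

  infixr 6 _∧ᵛ_

  _∧ᵛ_ : ∀ {N} → Vec Bool N → Vec Bool N → Vec Bool N
  _∧ᵛ_ = Vec.zipWith _∧_

  ∧ᵛ-[]≔ʳ : ∀ {N} (D z : Vec Bool N) i c → Vec.lookup D i ≡ true → D ∧ᵛ (z [ i ]≔ c) ≡ (D ∧ᵛ z) [ i ]≔ c
  ∧ᵛ-[]≔ʳ (true ∷ D) (b ∷ z) zero    c refl = refl
  ∧ᵛ-[]≔ʳ (d ∷ D)    (b ∷ z) (suc i) c Dᵢ   = cong (d ∧ b ∷_) (∧ᵛ-[]≔ʳ D z i c Dᵢ)

  ∧ᵛ-[]≔ˡ : ∀ {N} (D z : Vec Bool N) i d c → ((D [ i ]≔ d) ∧ᵛ z) [ i ]≔ c ≡ (D ∧ᵛ z) [ i ]≔ c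
  ∧ᵛ-[]≔ˡ (_ ∷ D) (b ∷ z) zero    d c = refl
  ∧ᵛ-[]≔ˡ (e ∷ D) (b ∷ z) (suc i) d c = cong (e ∧ b ∷_) (∧ᵛ-[]≔ˡ D z i d c)

  ∧ᵛ-[]≔-false : ∀ {N} (D z : Vec Bool N) i → Vec.lookup D i ≡ false → (D ∧ᵛ z) [ i ]≔ false ≡ D ∧ᵛ z
  ∧ᵛ-[]≔-false (false ∷ D) (b ∷ z) zero    refl = refl
  ∧ᵛ-[]≔-false (d ∷ D)     (b ∷ z) (suc i) Dᵢ   = cong (d ∧ b ∷_) (∧ᵛ-[]≔-false D z i Dᵢ)

  ∁ : ∀ {N} → Vec Bool N → Vec Bool N
  ∁ = Vec.map not

  ∁-involutive : ∀ {N} (D : Vec Bool N) → ∁ (∁ D) ≡ D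
  ∁-involutive D = trans (sym (map-∘ not not D)) (trans (map-cong Bool.not-involutive D) (map-id D))

  avg : ∀ {N} → (Vec Bool N → ℚ) → Vec Bool N → ℚ
  avg α D = 𝔼 (λ z → α (D ∧ᵛ z))

  -- For i in D this conditions on bit i; for i outside D it overwrites a bit that the mask has set
  -- to 0.
  cond : ∀ {N} → (Vec Bool N → ℚ) → Fin N → Bool → Vec Bool N → ℚ
  cond α i c D = 𝔼 (λ z → α ((D ∧ᵛ z) [ i ]≔ c))

  gap : ∀ {N} → (Vec Bool N → ℚ) → Fin N → Vec Bool N → ℚ
  gap α i D = excess (cond α i false D) (cond α i true D)

  -- Bit i is overwritten after masking, so whether i belongs to D cannot be seen.
  cond-[]≔ : ∀ {N} (α : Vec Bool N → ℚ) i c D d → cond α i c (D [ i ]≔ d) ≡ cond α i c D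
  cond-[]≔ {N} α i c D d = ext (𝔼-linear {N}) (λ z → cong α (∧ᵛ-[]≔ˡ D z i d c))

  cond-outside : ∀ {N} (α : Vec Bool N → ℚ) i D → Vec.lookup D i ≡ false → cond α i false D ≡ avg α D
  cond-outside {N} α i D Dᵢ = ext (𝔼-linear {N}) (λ z → cong α (∧ᵛ-[]≔-false D z i Dᵢ))

  -- Resampling bit i writes the correlation as half of a signed sum of the two conditional
  -- averages, hence the factor 2.
  cond-difference : ∀ {N} (α : Vec Bool N → ℚ) i D → Vec.lookup D i ≡ true →
    cond α i false D - cond α i true D ≡ 2ℚ * 𝔼 (λ z → α (D ∧ᵛ z) * sgn (Vec.lookup z i))
  cond-difference {N} α i D Dᵢ = sym (trans (cong (2ℚ *_) (trans (𝔼-resample i _)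
    (cong₂ (λ p q → ½ * (p + q)) (half false) (half true))))
    (solve 2 (λ a b → con 2ℚ :* (con ½ :* (a :* con 1ℚ :+ b :* con (- 1ℚ))) := a :- b) refl
       (cond α i false D) (cond α i true D)))
    where
    half : ∀ c → 𝔼 (λ z → α (D ∧ᵛ (z [ i ]≔ c)) * sgn (Vec.lookup (z [ i ]≔ c) i)) ≡ cond α i c D * sgn c
    half c = trans
      (ext (𝔼-linear {N}) (λ z → cong₂ (λ x b → α x * sgn b) (∧ᵛ-[]≔ʳ D z i c Dᵢ) (lookup∘updateAt i z)))
      (scaleʳ (𝔼-linear {N}) _ (sgn c))

  -- Bounds the mean of 40 times `r` to the power S - k, where S is a sum of at most N independent
  -- signs.
  η : ℕ → ℕ → ℚ
  η N k = 40ℚ * (cosh ^ N * r⁻¹ ^ k)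

  -- The sum of the gaps of one player.

  Fractional : ∀ {N} → (Vec Bool N → ℚ) → Set
  Fractional α = ∀ x → 0ℚ ≤ α x × α x ≤ 1ℚ

  module _ {N : ℕ} {α : Vec Bool N → ℚ} (frac : Fractional α) where

    0≤avg : ∀ D → 0ℚ ≤ avg α D
    0≤avg D = preserves-≥0 (𝔼-linear {N}) (λ z → proj₁ (frac _))

    avg≤1 : ∀ D → avg α D ≤ 1ℚ
    avg≤1 D = 𝔼≤ {N} (λ z → proj₂ (frac _))

    0≤cond : ∀ i c D → 0ℚ ≤ cond α i c D
    0≤cond i c D = preserves-≥0 (𝔼-linear {N}) (λ z → proj₁ (frac _))

    module _ (D : Vec Bool N) where

      -- The coordinates of D whose gap counts. They depend on α and D but not on z, so they are
      -- fixed coefficients in an average over z.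
      rising : Vec Bool N
      rising = Vec.tabulate (λ i → Vec.lookup D i ∧ (cond α i false D ≥ᵇ cond α i true D))

      gap-correlation : ∀ i → ind (Vec.lookup D i) * gap α i D
        ≡ 2ℚ * 𝔼 (λ z → α (D ∧ᵛ z) * (ind (Vec.lookup rising i) * sgn (Vec.lookup z i)))
      gap-correlation i rewrite lookup∘tabulate (λ i → Vec.lookup D i ∧ (cond α i false D ≥ᵇ cond α i true D)) i
        with Vec.lookup D i in Dᵢ
      ... | false = trans (*-zeroˡ (gap α i D)) (sym (trans (cong (2ℚ *_) (trans
              (ext (𝔼-linear {N}) (λ z → solve 2 (λ a s → a :* (con 0ℚ :* s) := con 0ℚ) refl (α (D ∧ᵛ z)) (sgn (Vec.lookup z i))))
              (vanish (𝔼-linear {N})))) (*-zeroʳ 2ℚ)))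
      ... | true = trans (*-identityˡ _) (trans (cong (ind σ *_) (cond-difference α i D Dᵢ)) (trans
              (solve 2 (λ s e → s :* (con 2ℚ :* e) := con 2ℚ :* (s :* e)) refl (ind σ) (𝔼 (λ z → α (D ∧ᵛ z) * sgn (Vec.lookup z i))))
              (cong (2ℚ *_) (trans (sym (scale (𝔼-linear {N}) (ind σ) _)) (ext (𝔼-linear {N}) λ z →
                 solve 3 (λ s a b → s :* (a :* b) := a :* (s :* b)) refl (ind σ) (α (D ∧ᵛ z)) (sgn (Vec.lookup z i)))))))
        where σ = cond α i false D ≥ᵇ cond α i true D

      -- The gaps of α add up to its correlation with a single ±1 walk, which exceeds k only with exponentially small probability.
      level-one : ∀ k → sumF (λ i → ind (Vec.lookup D i) * gap α i D) ≤ 2ℚ * (ι k * avg α D + η N k)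
      level-one k = begin
        sumF (λ i → ind (Vec.lookup D i) * gap α i D)
          ≡⟨ ext sumF-linear gap-correlation ⟩
        sumF (λ i → 2ℚ * 𝔼 (λ z → α (D ∧ᵛ z) * (ind (Vec.lookup rising i) * sgn (Vec.lookup z i))))
          ≡⟨ scale sumF-linear 2ℚ (λ i → 𝔼 (λ z → α (D ∧ᵛ z) * (ind (Vec.lookup rising i) * sgn (Vec.lookup z i)))) ⟩
        2ℚ * sumF (λ i → 𝔼 (λ z → α (D ∧ᵛ z) * (ind (Vec.lookup rising i) * sgn (Vec.lookup z i))))
          ≡⟨ cong (2ℚ *_) (𝔼-swap sumF-linear (λ i z → α (D ∧ᵛ z) * (ind (Vec.lookup rising i) * sgn (Vec.lookup z i)))) ⟩
        2ℚ * 𝔼 (λ z → sumF (λ i → α (D ∧ᵛ z) * (ind (Vec.lookup rising i) * sgn (Vec.lookup z i))))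
          ≡⟨ cong (2ℚ *_) (ext (𝔼-linear {N}) (λ z → scale sumF-linear (α (D ∧ᵛ z)) (λ i → ind (Vec.lookup rising i) * sgn (Vec.lookup z i)))) ⟩
        2ℚ * 𝔼 (λ z → α (D ∧ᵛ z) * deviation rising z)
          ≤⟨ *-monoˡ-≤ (nonNegative⁻¹ 2ℚ) (mono (𝔼-linear {N}) pointwise) ⟩
        2ℚ * 𝔼 (λ z → ι k * α (D ∧ᵛ z) + 40ℚ * (weight rising z * r⁻¹ ^ k))
          ≡⟨ cong (2ℚ *_) (add (𝔼-linear {N}) (λ z → ι k * α (D ∧ᵛ z)) (λ z → 40ℚ * (weight rising z * r⁻¹ ^ k))) ⟩
        2ℚ * (𝔼 (λ z → ι k * α (D ∧ᵛ z)) + 𝔼 (λ z → 40ℚ * (weight rising z * r⁻¹ ^ k)))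
          ≡⟨ cong (2ℚ *_) (cong₂ _+_ (scale (𝔼-linear {N}) (ι k) (λ z → α (D ∧ᵛ z)))
               (trans (scale (𝔼-linear {N}) 40ℚ (λ z → weight rising z * r⁻¹ ^ k)) (cong (40ℚ *_) (scaleʳ (𝔼-linear {N}) (weight rising) (r⁻¹ ^ k))))) ⟩
        2ℚ * (ι k * avg α D + 40ℚ * (𝔼 (weight rising) * r⁻¹ ^ k))
          ≤⟨ *-monoˡ-≤ (nonNegative⁻¹ 2ℚ) (+-monoʳ-≤ (ι k * avg α D) (*-monoˡ-≤ (nonNegative⁻¹ 40ℚ)
               (*-monoʳ-≤ (0≤^ 0≤r⁻¹ k) (𝔼-weight rising)))) ⟩
        2ℚ * (ι k * avg α D + η N k) ∎
        where
        open ≤-Reasoning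
        -- Only the error term is relaxed by α ≤ 1. The main term keeps its weight α, which makes
        -- the bound proportional to `avg α D`.
        pointwise : ∀ z → α (D ∧ᵛ z) * deviation rising z ≤ ι k * α (D ∧ᵛ z) + 40ℚ * (weight rising z * r⁻¹ ^ k)
        pointwise z = begin
          a * deviation rising z
            ≡⟨ cong (a *_) (sym (+-identityˡ (deviation rising z))) ⟩
          a * (0ℚ + deviation rising z)
            ≤⟨ *-monoˡ-≤ (proj₁ (frac (D ∧ᵛ z))) (deviation-bound rising z 0 k) ⟩
          a * (ι k + 40ℚ * (1ℚ * W))
            ≡⟨ solve 3 (λ a k w → a :* (k :+ con 40ℚ :* (con 1ℚ :* w)) := k :* a :+ a :* (con 40ℚ :* w)) refl a (ι k) W ⟩
          ι k * a + a * (40ℚ * W)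
            ≤⟨ +-monoʳ-≤ (ι k * a) (*-monoʳ-≤ (0≤p*q (nonNegative⁻¹ 40ℚ) (0≤p*q (0≤weight rising z) (0≤^ 0≤r⁻¹ k))) (proj₂ (frac (D ∧ᵛ z)))) ⟩
          ι k * a + 1ℚ * (40ℚ * W)
            ≡⟨ cong (ι k * a +_) (*-identityˡ (40ℚ * W)) ⟩
          ι k * a + 40ℚ * W ∎
          where a = α (D ∧ᵛ z)
                W = weight rising z * r⁻¹ ^ k

  -- Cross terms between the two players.

  0≤η : ∀ N k → 0ℚ ≤ η N k
  0≤η N k = 0≤p*q (nonNegative⁻¹ 40ℚ) (0≤p*q (0≤^ (nonNegative⁻¹ cosh) N) (0≤^ 0≤r⁻¹ k))

  -- As f ignores the fair bit i, restricting to sets D that contain i loses exactly half of the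
  -- mean.
  𝔼-half : ∀ {N} (i : Fin N) (f : Vec Bool N → ℚ) → (∀ D d → f (D [ i ]≔ d) ≡ f D) →
           𝔼 f ≡ 2ℚ * 𝔼 (λ D → ind (Vec.lookup D i) * f D)
  𝔼-half {N} i f indep = sym (trans (cong (2ℚ *_) (trans (𝔼-resample i (λ D → ind (Vec.lookup D i) * f D))
    (cong₂ (λ p q → ½ * (p + q)) (half false) (half true))))
    (solve 1 (λ e → con 2ℚ :* (con ½ :* (con 0ℚ :* e :+ con 1ℚ :* e)) := e) refl (𝔼 f)))
    where
    half : ∀ d → 𝔼 (λ D → ind (Vec.lookup (D [ i ]≔ d) i) * f (D [ i ]≔ d)) ≡ ind d * 𝔼 f
    half d = trans (ext (𝔼-linear {N}) (λ D → cong₂ (λ b p → ind b * p) (lookup∘updateAt i D) (indep D d)))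
                   (scale (𝔼-linear {N}) (ind d) f)

  module _ {N : ℕ} {α β : Vec Bool N → ℚ} (fracα : Fractional α) (fracβ : Fractional β) where

    cross-indep : ∀ i D d → gap α i (D [ i ]≔ d) * cond β i false (∁ (D [ i ]≔ d)) ≡ gap α i D * cond β i false (∁ D)
    cross-indep i D d = cong₂ _*_
      (cong₂ excess (cond-[]≔ α i false D d) (cond-[]≔ α i true D d))
      (trans (cong (cond β i false) (map-[]≔ not D i)) (cond-[]≔ β i false (∁ D) (not d)))

    -- If Alice owns i, then Bob's bit there is already 0 and forcing it changes nothing. Bob's
    -- factor becomes independent of i and leaves the sum over i.
    cross-inside : ∀ i D → ind (Vec.lookup D i) * (gap α i D * cond β i false (∁ D)) ≡ ind (Vec.lookup D i) * gap α i D * avg β (∁ D)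
    cross-inside i D with Vec.lookup D i in Dᵢ
    ... | false = trans (*-zeroˡ (gap α i D * cond β i false (∁ D)))
                    (solve 2 (λ g a → con 0ℚ := con 0ℚ :* g :* a) refl (gap α i D) (avg β (∁ D)))
    ... | true  = trans (cong (λ c → 1ℚ * (gap α i D * c)) (cond-outside β i (∁ D) (trans (lookup-map i not D) (cong not Dᵢ))))
                    (sym (*-assoc 1ℚ (gap α i D) (avg β (∁ D))))

    -- Both factors ignore whether i is in D, so `𝔼-half` may impose it; `level-one` then bounds the
    -- sum over i for each D. The 4 is the product of their two factors 2.
    cross-bound : ∀ k → sumF (λ i → 𝔼 (λ D → gap α i D * cond β i false (∁ D)))
                  ≤ 4ℚ * (ι k * 𝔼 (λ D → avg α D * avg β (∁ D)) + η N k)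
    cross-bound k = begin
      sumF (λ i → 𝔼 (λ D → gap α i D * cond β i false (∁ D)))
        ≡⟨ ext sumF-linear (λ i → trans (𝔼-half i _ (cross-indep i)) (cong (2ℚ *_) (ext 𝔼ᴺ (cross-inside i)))) ⟩
      sumF (λ i → 2ℚ * 𝔼 (λ D → ind (Vec.lookup D i) * gap α i D * avg β (∁ D)))
        ≡⟨ scale sumF-linear 2ℚ (λ i → 𝔼 (λ D → ind (Vec.lookup D i) * gap α i D * avg β (∁ D))) ⟩
      2ℚ * sumF (λ i → 𝔼 (λ D → ind (Vec.lookup D i) * gap α i D * avg β (∁ D)))
        ≡⟨ cong (2ℚ *_) (𝔼-swap sumF-linear (λ i D → ind (Vec.lookup D i) * gap α i D * avg β (∁ D))) ⟩
      2ℚ * 𝔼 (λ D → sumF (λ i → ind (Vec.lookup D i) * gap α i D * avg β (∁ D)))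
        ≡⟨ cong (2ℚ *_) (ext 𝔼ᴺ (λ D → scaleʳ sumF-linear (λ i → ind (Vec.lookup D i) * gap α i D) (avg β (∁ D)))) ⟩
      2ℚ * 𝔼 (λ D → sumF (λ i → ind (Vec.lookup D i) * gap α i D) * avg β (∁ D))
        ≤⟨ *-monoˡ-≤ (nonNegative⁻¹ 2ℚ) (mono 𝔼ᴺ pointwise) ⟩
      2ℚ * 𝔼 (λ D → 2ℚ * ι k * (avg α D * avg β (∁ D)) + 2ℚ * η N k)
        ≡⟨ cong (2ℚ *_) (trans (add 𝔼ᴺ _ _) (cong₂ _+_ (scale 𝔼ᴺ (2ℚ * ι k) _) (𝔼-const N (2ℚ * η N k)))) ⟩
      2ℚ * (2ℚ * ι k * M + 2ℚ * η N k)
        ≡⟨ solve 3 (λ k m e → con 2ℚ :* (con 2ℚ :* k :* m :+ con 2ℚ :* e) := con 4ℚ :* (k :* m :+ e)) refl (ι k) M (η N k) ⟩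
      4ℚ * (ι k * M + η N k) ∎
      where
      open ≤-Reasoning
      𝔼ᴺ = 𝔼-linear {N}
      M = 𝔼 (λ D → avg α D * avg β (∁ D))
      pointwise : ∀ D → sumF (λ i → ind (Vec.lookup D i) * gap α i D) * avg β (∁ D)
                      ≤ 2ℚ * ι k * (avg α D * avg β (∁ D)) + 2ℚ * η N k
      pointwise D = begin
        sumF (λ i → ind (Vec.lookup D i) * gap α i D) * b
          ≤⟨ *-monoʳ-≤ (0≤avg fracβ (∁ D)) (level-one fracα D k) ⟩
        2ℚ * (ι k * a + η N k) * b
          ≡⟨ solve 4 (λ k a e b → con 2ℚ :* (k :* a :+ e) :* b := con 2ℚ :* k :* (a :* b) :+ con 2ℚ :* e :* b) refl (ι k) a (η N k) b ⟩
        2ℚ * ι k * (a * b) + 2ℚ * η N k * b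
          ≤⟨ +-monoʳ-≤ (2ℚ * ι k * (a * b)) (*-monoˡ-≤ (0≤p*q (nonNegative⁻¹ 2ℚ) (0≤η N k)) (avg≤1 fracβ (∁ D))) ⟩
        2ℚ * ι k * (a * b) + 2ℚ * η N k * 1ℚ
          ≡⟨ cong (2ℚ * ι k * (a * b) +_) (*-identityʳ (2ℚ * η N k)) ⟩
        2ℚ * ι k * (a * b) + 2ℚ * η N k ∎
        where a = avg α D
              b = avg β (∁ D)

  -- Planted instances and the bound for rectangles.

  Inputs : ℕ → Set
  Inputs N = Vec Bool N × Vec Bool N

  Samples : ℕ → Set
  Samples N = Fin N × Vec Bool N × Vec Bool N × Vec Bool N

  -- D is the set of coordinates owned by Alice.
  instance-at : ∀ {N} → Bool → Samples N → Inputs N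
  instance-at c (i , D , z , z′) = (D ∧ᵛ z) [ i ]≔ c , (∁ D ∧ᵛ z′) [ i ]≔ c

  -- The coordinate is summed rather than averaged, so the total mass is N, whereas `unplanted` has
  -- mass 1.
  planted : ∀ {N} → Bool → (Inputs N → ℚ) → ℚ
  planted {N} c g = (sumF ⊗ 𝔼 {N} ⊗ 𝔼 {N} ⊗ 𝔼 {N}) (g ∘ instance-at c)

  unplanted : ∀ {N} → (Inputs N → ℚ) → ℚ
  unplanted {N} g = (𝔼 {N} ⊗ 𝔼 {N} ⊗ 𝔼 {N}) (λ (D , z , z′) → g (D ∧ᵛ z , ∁ D ∧ᵛ z′))

  planted-linear : ∀ {N} c → PositiveLinear (planted {N} c)
  planted-linear {N} c = pullback-linear (instance-at c)
    (⊗-linear sumF-linear (⊗-linear (𝔼-linear {N}) (⊗-linear (𝔼-linear {N}) (𝔼-linear {N}))))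

  unplanted-linear : ∀ {N} → PositiveLinear (unplanted {N})
  unplanted-linear {N} = pullback-linear _ (⊗-linear (𝔼-linear {N}) (⊗-linear (𝔼-linear {N}) (𝔼-linear {N})))

  rectangle : ∀ {N} → (Vec Bool N → ℚ) → (Vec Bool N → ℚ) → Inputs N → ℚ
  rectangle α β (x , y) = α x * β y

  -- Given i and D the two inputs are independent, so each mass is a sum of products and
  -- `product-excess` applies termwise. The two families of cross terms cost 4 each.
  rectangle-bound : ∀ {N} {α β : Vec Bool N → ℚ} → Fractional α → Fractional β → ∀ k →
    planted false (rectangle α β)
      ≤ planted true (rectangle α β) + 8ℚ * (ι k * unplanted (rectangle α β) + η N k)
  rectangle-bound {N} {α} {β} fracα fracβ k = begin
    planted false (rectangle α β)
      ≡⟨ factorise false ⟩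
    sumF (λ i → 𝔼 (λ D → cond α i false D * cond β i false (∁ D)))
      ≤⟨ mono sumF-linear (λ i → mono 𝔼ᴺ (λ D → product-excess
           (0≤cond fracα i false D) (0≤cond fracα i true D) (0≤cond fracβ i false (∁ D)) (0≤cond fracβ i true (∁ D)))) ⟩
    sumF (λ i → 𝔼 (λ D → p₁ i D + (p₂ i D + p₃ i D)))
      ≡⟨ ext sumF-linear (λ i → trans (add 𝔼ᴺ (p₁ i) _) (cong (𝔼 (p₁ i) +_) (add 𝔼ᴺ (p₂ i) (p₃ i)))) ⟩
    sumF (λ i → 𝔼 (p₁ i) + (𝔼 (p₂ i) + 𝔼 (p₃ i)))
      ≡⟨ trans (add sumF-linear (λ i → 𝔼 (p₁ i)) (λ i → 𝔼 (p₂ i) + 𝔼 (p₃ i)))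
           (cong (sumF (λ i → 𝔼 (p₁ i)) +_) (add sumF-linear (λ i → 𝔼 (p₂ i)) (λ i → 𝔼 (p₃ i)))) ⟩
    sumF (λ i → 𝔼 (p₁ i)) + (sumF (λ i → 𝔼 (p₂ i)) + sumF (λ i → 𝔼 (p₃ i)))
      ≤⟨ +-mono-≤ (≤-reflexive (sym (factorise true))) (+-mono-≤ (cross-bound fracα fracβ k) mirrored) ⟩
    planted true (rectangle α β) + (4ℚ * (ι k * M + η N k) + 4ℚ * (ι k * M + η N k))
      ≡⟨ cong (planted true (rectangle α β) +_) (trans
           (solve 1 (λ e → con 4ℚ :* e :+ con 4ℚ :* e := con 8ℚ :* e) refl (ι k * M + η N k))
           (cong (λ e → 8ℚ * (ι k * e + η N k)) (sym (ext 𝔼ᴺ (λ D → 𝔼-product (λ z → α (D ∧ᵛ z)) (λ z → β (∁ D ∧ᵛ z))))))) ⟩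
    planted true (rectangle α β) + 8ℚ * (ι k * unplanted (rectangle α β) + η N k) ∎
    where
    open ≤-Reasoning
    𝔼ᴺ = 𝔼-linear {N}
    M = 𝔼 (λ D → avg α D * avg β (∁ D))
    p₁ p₂ p₃ : Fin N → Vec Bool N → ℚ
    p₁ i D = cond α i true D * cond β i true (∁ D)
    p₂ i D = gap α i D * cond β i false (∁ D)
    p₃ i D = gap β i (∁ D) * cond α i false D

    factorise : ∀ c → planted c (rectangle α β) ≡ sumF (λ i → 𝔼 (λ D → cond α i c D * cond β i c (∁ D)))
    factorise c = ext sumF-linear (λ i → ext 𝔼ᴺ (λ D →
      𝔼-product (λ z → α ((D ∧ᵛ z) [ i ]≔ c)) (λ z → β ((∁ D ∧ᵛ z) [ i ]≔ c))))

    -- Complementing D hands each player the other's coordinates and reduces this to `cross-bound`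
    -- with α and β exchanged.
    mirrored : sumF (λ i → 𝔼 (p₃ i)) ≤ 4ℚ * (ι k * M + η N k)
    mirrored = begin
      sumF (λ i → 𝔼 (p₃ i))
        ≡⟨ ext sumF-linear (λ i → trans (𝔼-complement (p₃ i))
             (ext 𝔼ᴺ (λ D → cong (λ D′ → gap β i D′ * cond α i false (∁ D)) (∁-involutive D)))) ⟩
      sumF (λ i → 𝔼 (λ D → gap β i D * cond α i false (∁ D)))
        ≤⟨ cross-bound fracβ fracα k ⟩
      4ℚ * (ι k * 𝔼 (λ D → avg β D * avg α (∁ D)) + η N k)
        ≡⟨ cong (λ e → 4ℚ * (ι k * e + η N k)) (trans (𝔼-complement (λ D → avg β D * avg α (∁ D)))
             (ext 𝔼ᴺ (λ D → trans (cong (λ D′ → avg β (∁ D) * avg α D′) (∁-involutive D)) (*-comm (avg β (∁ D)) (avg α D))))) ⟩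
      4ℚ * (ι k * M + η N k) ∎

  -- Truncated decision trees.

  accept : ∀ {n} → ℕ → Tree n → Profile n → Bool
  accept K       (leaf b)     P = b
  accept zero    (node q l r) P = false
  accept (suc K) (node q l r) P = if q P then accept K r P else accept K l P

  -- An exhausted budget counts as rejection, so truncation can only lose acceptance. On
  -- intersecting inputs this is the harmless direction.
  accept≤output : ∀ {n} K (t : Tree n) P → ind (accept K t P) ≤ ind (output t P)
  accept≤output K       (leaf b)     P = ≤-refl
  accept≤output zero    (node q l r) P = 0≤ind (output (node q l r) P)
  accept≤output (suc K) (node q l r) P with q P
  ... | true  = accept≤output K r P
  ... | false = accept≤output K l P

  -- A pointwise Markov inequality: truncation changes the answer only on runs of at least K + 1
  -- queries, and there the cost alone covers the left side.
  output≤accept : ∀ {n} K (t : Tree n) P →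
    ι (suc K) * ind (output t P) ≤ ι (suc K) * ind (accept K t P) + ι (cost t P)
  output≤accept {n} K t P = goal K t (late K t)
    where
    late : ∀ K t → accept K t P ≡ output t P ⊎ K ℕ.< cost t P
    late K       (leaf b)     = inj₁ refl
    late zero    (node q l r) with q P
    ... | true  = inj₂ (ℕ.s≤s ℕ.z≤n)
    ... | false = inj₂ (ℕ.s≤s ℕ.z≤n)
    late (suc K) (node q l r) with q P
    ... | true  = [ inj₁ , inj₂ ∘ ℕ.s≤s ]′ (late K r)
    ... | false = [ inj₁ , inj₂ ∘ ℕ.s≤s ]′ (late K l)

    goal : ∀ K t → accept K t P ≡ output t P ⊎ K ℕ.< cost t P →
           ι (suc K) * ind (output t P) ≤ ι (suc K) * ind (accept K t P) + ι (cost t P)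
    goal K t (inj₁ eq) rewrite eq = p+x≤q⇒p≤q ≤-refl (0≤ι (cost t P))
    goal K t (inj₂ K<cost) = begin
      ι (suc K) * ind (output t P)                       ≤⟨ *-monoˡ-≤ (0≤ι (suc K)) (ind≤1 (output t P)) ⟩
      ι (suc K) * 1ℚ                                     ≡⟨ *-identityʳ (ι (suc K)) ⟩
      ι (suc K)                                          ≤⟨ ι-mono K<cost ⟩
      ι (cost t P)                                       ≡⟨ sym (+-identityˡ (ι (cost t P))) ⟩
      0ℚ + ι (cost t P)                                  ≤⟨ +-monoˡ-≤ (ι (cost t P)) (0≤p*q (0≤ι (suc K)) (0≤ind (accept K t P))) ⟩
      ι (suc K) * ind (accept K t P) + ι (cost t P) ∎
      where open ≤-Reasoning

  -- From rectangles to decision trees.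

  record Bounded {N : ℕ} (k : ℕ) (g : Inputs N → ℚ) (e : ℚ) : Set where
    constructor bounded
    field bound : planted false g ≤ planted true g + 8ℚ * (ι k * unplanted g + e)

  module _ {N : ℕ} {k : ℕ} where

    bounded-ext : ∀ {g h : Inputs N → ℚ} {e} → (∀ xy → h xy ≡ g xy) → Bounded k g e → Bounded k h e
    bounded-ext {g} {h} {e} h≡g (bounded bound) = bounded (subst₂ _≤_ (ext (planted-linear false) (sym ∘ h≡g))
      (cong₂ (λ s m → s + 8ℚ * (ι k * m + e)) (ext (planted-linear true) (sym ∘ h≡g)) (ext unplanted-linear (sym ∘ h≡g))) bound)

    bounded-weaken : ∀ {g : Inputs N → ℚ} {e e′} → e ≤ e′ → Bounded k g e → Bounded k g e′
    bounded-weaken {g} e≤e′ (bounded bound) = bounded (≤-trans bound (+-monoʳ-≤ (planted true g)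
      (*-monoˡ-≤ (nonNegative⁻¹ 8ℚ) (+-monoʳ-≤ (ι k * unplanted g) e≤e′))))

    bounded-zero : ∀ {e} → 0ℚ ≤ e → Bounded {N} k (λ _ → 0ℚ) e
    bounded-zero {e} 0≤e = bounded (begin
      planted {N} false (λ _ → 0ℚ)  ≡⟨ vanish (planted-linear {N} false) ⟩
      0ℚ                        ≤⟨ 0≤p*q (nonNegative⁻¹ 8ℚ) 0≤e ⟩
      8ℚ * e                    ≡⟨ solve 2 (λ k e → con 8ℚ :* e := con 0ℚ :+ con 8ℚ :* (k :* con 0ℚ :+ e)) refl (ι k) e ⟩
      0ℚ + 8ℚ * (ι k * 0ℚ + e)  ≡⟨ cong₂ (λ s m → s + 8ℚ * (ι k * m + e)) (sym (vanish (planted-linear {N} true))) (sym (vanish (unplanted-linear {N}))) ⟩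
      planted {N} true (λ _ → 0ℚ) + 8ℚ * (ι k * unplanted {N} (λ _ → 0ℚ) + e) ∎)
      where open ≤-Reasoning

    -- Every term is linear in the function, so the inequalities of the leaves of a tree can be
    -- summed, and only the errors accumulate.
    bounded-add : ∀ {g h : Inputs N → ℚ} {d e} → Bounded k g d → Bounded k h e → Bounded k (λ xy → g xy + h xy) (d + e)
    bounded-add {g} {h} {d} {e} (bounded bg) (bounded bh) = bounded (begin
      planted false (λ xy → g xy + h xy)
        ≡⟨ add (planted-linear false) g h ⟩
      planted false g + planted false h
        ≤⟨ +-mono-≤ bg bh ⟩
      (planted true g + 8ℚ * (ι k * unplanted g + d)) + (planted true h + 8ℚ * (ι k * unplanted h + e))
        ≡⟨ solve 7 (λ k s s′ m m′ d e → (s :+ con 8ℚ :* (k :* m :+ d)) :+ (s′ :+ con 8ℚ :* (k :* m′ :+ e))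
             := (s :+ s′) :+ con 8ℚ :* (k :* (m :+ m′) :+ (d :+ e))) refl
             (ι k) (planted true g) (planted true h) (unplanted g) (unplanted h) d e ⟩
      (planted true g + planted true h) + 8ℚ * (ι k * (unplanted g + unplanted h) + (d + e))
        ≡⟨ cong₂ (λ s m → s + 8ℚ * (ι k * m + (d + e))) (sym (add (planted-linear true) g h)) (sym (add unplanted-linear g h)) ⟩
      planted true (λ xy → g xy + h xy) + 8ℚ * (ι k * unplanted (λ xy → g xy + h xy) + (d + e)) ∎)
      where open ≤-Reasoning

  restrict : ∀ {N} → (Vec Bool N → ℚ) → (Vec Bool N → Bool) → Vec Bool N → ℚ
  restrict α p x = α x * ind (p x)

  restrict-fractional : ∀ {N} {α : Vec Bool N → ℚ} → Fractional α → ∀ p → Fractional (restrict α p)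
  restrict-fractional {α = α} frac p x =
    0≤p*q (proj₁ (frac x)) (0≤ind (p x)) ,
    ≤-trans (*-monoˡ-≤ (proj₁ (frac x)) (ind≤1 (p x))) (≤-trans (≤-reflexive (*-identityʳ (α x))) (proj₂ (frac x)))

  1≤2^ : ∀ K → 1ℚ ≤ 2ℚ ^ K
  1≤2^ zero    = ≤-refl
  1≤2^ (suc K) = ≤-trans (1≤2^ K) (≤-trans (≤-reflexive (sym (*-identityˡ (2ℚ ^ K))))
    (*-monoʳ-≤ (0≤^ (nonNegative⁻¹ 2ℚ) K) (toWitness {a? = 1ℚ ≤? 2ℚ} _)))

  -- On encoded inputs the query is a one-bit message, from Alice in the first case and from Bob in
  -- the second.
  Local : ∀ {n N} → (Inputs N → Profile n) → (Profile n → Bool) → Set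
  Local enc q = (∀ x y y′ → q (enc (x , y)) ≡ q (enc (x , y′))) ⊎ (∀ x x′ y → q (enc (x , y)) ≡ q (enc (x′ , y)))

  module _ {n m N : ℕ} {batch : Fin n → Fin m} (enc : Inputs N → Profile n)
           (local : ∀ {q} → AllowedQuery batch q → Local enc q) (k : ℕ) where

    -- A local query splits one side of the current rectangle in two, so each leaf is reached on a
    -- rectangle. At depth K there are at most 2 to the K leaves, each with error `η N k`.
    tree-bound : ∀ {t} → AllowedTree batch t → ∀ K {α β : Vec Bool N → ℚ} → Fractional α → Fractional β →
      Bounded k (λ xy → rectangle α β xy * ind (accept K t (enc xy))) (2ℚ ^ K * η N k)
    tree-bound (leaf false) K {α} {β} _ _ =
      bounded-ext (λ xy → *-zeroʳ (rectangle α β xy)) (bounded-zero {N} (0≤p*q (0≤^ (nonNegative⁻¹ 2ℚ) K) (0≤η N k)))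
    tree-bound (leaf true) K {α} {β} fα fβ =
      bounded-ext (λ xy → *-identityʳ (rectangle α β xy)) (bounded-weaken {N} {g = rectangle α β}
        (≤-trans (≤-reflexive (sym (*-identityˡ (η N k)))) (*-monoʳ-≤ (0≤η N k) (1≤2^ K)))
        (bounded (rectangle-bound fα fβ k)))
    tree-bound (node _ _ _) zero {α} {β} _ _ =
      bounded-ext (λ xy → *-zeroʳ (rectangle α β xy)) (bounded-zero {N} (0≤p*q (nonNegative⁻¹ 1ℚ) (0≤η N k)))
    tree-bound (node {q} {l} {r} allowed lᵃ rᵃ) (suc K) {α} {β} fα fβ = by (local allowed)
      where
      twice : 2ℚ ^ K * η N k + 2ℚ ^ K * η N k ≡ 2ℚ ^ suc K * η N k
      twice = solve 2 (λ p e → p :* e :+ p :* e := (con 2ℚ :* p) :* e) refl (2ℚ ^ K) (η N k)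

      splitˡ : ∀ a b u v c → (a * b) * ind (if c then u else v) ≡ ((a * ind (not c)) * b) * ind v + ((a * ind c) * b) * ind u
      splitˡ a b u v true  = solve 4 (λ a b u v → (a :* b) :* u := ((a :* con 0ℚ) :* b) :* v :+ ((a :* con 1ℚ) :* b) :* u) refl a b (ind u) (ind v)
      splitˡ a b u v false = solve 4 (λ a b u v → (a :* b) :* v := ((a :* con 1ℚ) :* b) :* v :+ ((a :* con 0ℚ) :* b) :* u) refl a b (ind u) (ind v)

      splitʳ : ∀ a b u v c → (a * b) * ind (if c then u else v) ≡ (a * (b * ind (not c))) * ind v + (a * (b * ind c)) * ind u
      splitʳ a b u v true  = solve 4 (λ a b u v → (a :* b) :* u := (a :* (b :* con 0ℚ)) :* v :+ (a :* (b :* con 1ℚ)) :* u) refl a b (ind u) (ind v)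
      splitʳ a b u v false = solve 4 (λ a b u v → (a :* b) :* v := (a :* (b :* con 1ℚ)) :* v :+ (a :* (b :* con 0ℚ)) :* u) refl a b (ind u) (ind v)

      goal : ℚ → Set
      goal = Bounded k (λ xy → rectangle α β xy * ind (if q (enc xy) then accept K r (enc xy) else accept K l (enc xy)))

      by : Local enc q → goal (2ℚ ^ suc K * η N k)
      by (inj₁ onˡ) = subst goal twice (bounded-ext
        (λ (x , y) → trans
          (cong (λ c → (α x * β y) * ind (if c then accept K r (enc (x , y)) else accept K l (enc (x , y)))) (onˡ x y (Vec.replicate N false)))
          (splitˡ (α x) (β y) (accept K r (enc (x , y))) (accept K l (enc (x , y))) (p x)))
        (bounded-add {N} (tree-bound lᵃ K (restrict-fractional fα (not ∘ p)) fβ) (tree-bound rᵃ K (restrict-fractional fα p) fβ)))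
        where
        p : Vec Bool N → Bool
        -- Any value would do for Bob's input, since the answer does not depend on it.
        p x = q (enc (x , Vec.replicate N false))
      by (inj₂ onʳ) = subst goal twice (bounded-ext
        (λ (x , y) → trans
          (cong (λ c → (α x * β y) * ind (if c then accept K r (enc (x , y)) else accept K l (enc (x , y)))) (onʳ x (Vec.replicate N false) y))
          (splitʳ (α x) (β y) (accept K r (enc (x , y))) (accept K l (enc (x , y))) (p y)))
        (bounded-add {N} (tree-bound lᵃ K fα (restrict-fractional fβ (not ∘ p))) (tree-bound rᵃ K fα (restrict-fractional fβ p))))
        where
        p : Vec Bool N → Bool
        p y = q (enc (Vec.replicate N false , y))

    accept-bound : ∀ {t} → AllowedTree batch t → ∀ K → Bounded k (λ xy → ind (accept K t (enc xy))) (2ℚ ^ K * η N k)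
    accept-bound {t} tᵃ K = bounded-ext
      (λ xy → solve 1 (λ a → a := (con 1ℚ :* con 1ℚ) :* a) refl (ind (accept K t (enc xy))))
      (tree-bound tᵃ K one one)
      where
      one : Fractional {N} (λ _ → 1ℚ)
      one _ = nonNegative⁻¹ 1ℚ , ≤-refl

  -- Mixtures of deterministic trees.

  mixture : ∀ {X : Set} → List (ℚ × X) → (X → ℚ) → ℚ
  mixture L f = sumℚ (mapL (λ wt → proj₁ wt * f (proj₂ wt)) L)

  module _ {X : Set} where

    mixture-mono : ∀ (L : List (ℚ × X)) {f g} → (∀ {w t} → (w , t) ∈ L → 0ℚ ≤ w) →
                   (∀ {w t} → (w , t) ∈ L → f t ≤ g t) → mixture L f ≤ mixture L g
    mixture-mono []      0≤w f≤g = ≤-refl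
    mixture-mono (x ∷ L) 0≤w f≤g = +-mono-≤ (*-monoˡ-≤ (0≤w (here refl)) (f≤g (here refl)))
                                            (mixture-mono L (0≤w ∘ there) (f≤g ∘ there))

    mixture-add : ∀ (L : List (ℚ × X)) f g → mixture L (λ t → f t + g t) ≡ mixture L f + mixture L g
    mixture-add []            f g = refl
    mixture-add ((w , t) ∷ L) f g = trans (cong (w * (f t + g t) +_) (mixture-add L f g))
      (solve 5 (λ w a b c d → w :* (a :+ b) :+ (c :+ d) := (w :* a :+ c) :+ (w :* b :+ d)) refl
        w (f t) (g t) (mixture L f) (mixture L g))

    mixture-scale : ∀ (L : List (ℚ × X)) c f → mixture L (λ t → c * f t) ≡ c * mixture L f
    mixture-scale []            c f = sym (*-zeroʳ c)
    mixture-scale ((w , t) ∷ L) c f = trans (cong (w * (c * f t) +_) (mixture-scale L c f))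
      (solve 4 (λ w c a b → w :* (c :* a) :+ c :* b := c :* (w :* a :+ b)) refl w c (f t) (mixture L f))

    mixture-const : ∀ (L : List (ℚ × X)) c → mixture L (λ _ → c) ≡ sumℚ (mapL proj₁ L) * c
    mixture-const []            c = sym (*-zeroˡ c)
    mixture-const ((w , t) ∷ L) c = trans (cong (w * c +_) (mixture-const L c)) (sym (*-distribʳ-+ c w (sumℚ (mapL proj₁ L))))

    mixture-swap : ∀ {Y : Set} {Φ : (Y → ℚ) → ℚ} → PositiveLinear Φ → (L : List (ℚ × X)) (f : X → Y → ℚ) →
                   Φ (λ y → mixture L (λ t → f t y)) ≡ mixture L (λ t → Φ (f t))
    mixture-swap lin []            f = vanish lin
    mixture-swap lin ((w , t) ∷ L) f = trans (add lin (λ y → w * f t y) (λ y → mixture L (λ t → f t y)))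
      (cong₂ _+_ (scale lin w (f t)) (mixture-swap lin L f))

  sum-cong : ∀ {X : Set} {f g : X → ℚ} → (∀ x → f x ≡ g x) → ∀ L → sumℚ (mapL f L) ≡ sumℚ (mapL g L)
  sum-cong f≡g []      = refl
  sum-cong f≡g (x ∷ L) = cong₂ _+_ (f≡g x) (sum-cong f≡g L)

  -- The summand of probOutput mentions a function local to its definition, so it is only available by unification.
  probOutput-summand : ∀ {n} (R : Randomized n) P b → ∃ λ f → probOutput R P b ≡ sumℚ (mapL f (support R))
  probOutput-summand R P b = _ , refl

  probOutput-true : ∀ {n} (R : Randomized n) P →
                    probOutput R P true ≡ mixture (support R) (λ t → ind (output t P))
  probOutput-true R P = trans (proj₂ (probOutput-summand R P true)) (sum-cong summand (support R))
    where
    summand : ∀ wt → proj₁ (probOutput-summand R P true) wt ≡ proj₁ wt * ind (output (proj₂ wt) P)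
    summand (w , t) with output t P
    ... | true  = sym (*-identityʳ w)
    ... | false = sym (*-zeroʳ w)

  probOutput-false : ∀ {n} (R : Randomized n) P →
                     probOutput R P false ≡ mixture (support R) (λ t → ind (not (output t P)))
  probOutput-false R P = trans (proj₂ (probOutput-summand R P false)) (sum-cong summand (support R))
    where
    summand : ∀ wt → proj₁ (probOutput-summand R P false) wt ≡ proj₁ wt * ind (not (output (proj₂ wt) P))
    summand (w , t) with output t P
    ... | true  = sym (*-zeroʳ w)
    ... | false = sym (*-identityʳ w)

  probOutput-total : ∀ {n} (R : Randomized n) P → probOutput R P true + probOutput R P false ≡ 1ℚ
  probOutput-total R P = begin
    probOutput R P true + probOutput R P false
      ≡⟨ cong₂ _+_ (probOutput-true R P) (probOutput-false R P) ⟩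
    mixture (support R) (λ t → ind (output t P)) + mixture (support R) (λ t → ind (not (output t P)))
      ≡⟨ sym (mixture-add (support R) (λ t → ind (output t P)) (λ t → ind (not (output t P)))) ⟩
    mixture (support R) (λ t → ind (output t P) + ind (not (output t P)))
      ≡⟨ sum-cong (λ (w , t) → cong (w *_) (exclusive (output t P))) (support R) ⟩
    mixture (support R) (λ _ → 1ℚ)
      ≡⟨ mixture-const (support R) 1ℚ ⟩
    sumℚ (mapL proj₁ (support R)) * 1ℚ
      ≡⟨ cong (_* 1ℚ) (total R) ⟩
    1ℚ ∎
    where
    open ≡-Reasoning
    exclusive : ∀ b → ind b + ind (not b) ≡ 1ℚ
    exclusive true  = refl
    exclusive false = refl

  -- Laws of powers and numerical decay.

  ^-+ : ∀ p m n → p ^ (m ℕ.+ n) ≡ p ^ m * p ^ n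
  ^-+ p zero    n = sym (*-identityˡ (p ^ n))
  ^-+ p (suc m) n = trans (cong (p *_) (^-+ p m n)) (sym (*-assoc p (p ^ m) (p ^ n)))

  *-^ : ∀ p q n → (p * q) ^ n ≡ p ^ n * q ^ n
  *-^ p q zero    = refl
  *-^ p q (suc n) = trans (cong (p * q *_) (*-^ p q n))
    (solve 4 (λ p q a b → (p :* q) :* (a :* b) := (p :* a) :* (q :* b)) refl p q (p ^ n) (q ^ n))

  1^ : ∀ n → 1ℚ ^ n ≡ 1ℚ
  1^ zero    = refl
  1^ (suc n) = trans (*-identityˡ (1ℚ ^ n)) (1^ n)

  ^-* : ∀ p m n → p ^ (m ℕ.* n) ≡ (p ^ m) ^ n
  ^-* p zero    n = sym (1^ n)
  ^-* p (suc m) n = trans (^-+ p n (m ℕ.* n)) (trans (cong (p ^ n *_) (^-* p m n)) (sym (*-^ p (p ^ m) n)))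

  ^-mono : ∀ {p q} → 0ℚ ≤ p → p ≤ q → ∀ n → p ^ n ≤ q ^ n
  ^-mono         0≤p p≤q zero    = ≤-refl
  ^-mono {p} {q} 0≤p p≤q (suc n) =
    ≤-trans (*-monoʳ-≤ (0≤^ 0≤p n) p≤q) (*-monoˡ-≤ (≤-trans 0≤p p≤q) (^-mono 0≤p p≤q n))

  -- Milestones of the numerical estimate: `cosh ^ 40` is at most 81/80, and 81/80 times `r⁻¹` is
  -- 81/82; ten factors 81/82 fall below 9/10, and sixteen factors 9/10 below 1/2.
  81/80 81/82 9/10 : ℚ
  81/80 = ℤ.+ 81 / 80
  81/82 = ℤ.+ 81 / 82
  9/10  = ℤ.+ 9 / 10

  cosh^40 : cosh ^ 40 ≤ 81/80
  cosh^40 = toWitness {a? = cosh ^ 40 ≤? 81/80} _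

  81/82^10 : 81/82 ^ 10 ≤ 9/10
  81/82^10 = toWitness {a? = 81/82 ^ 10 ≤? 9/10} _

  9/10^16 : 2ℚ * 9/10 ^ 16 ≤ 1ℚ
  9/10^16 = toWitness {a? = 2ℚ * 9/10 ^ 16 ≤? 1ℚ} _

  decay-unit : ∀ {c} → 0ℚ ≤ c → c ≤ 81/82 → 2ℚ * (c ^ 10) ^ 16 ≤ 1ℚ
  decay-unit 0≤c c≤81/82 = ≤-trans (*-monoˡ-≤ (nonNegative⁻¹ 2ℚ)
    (^-mono (0≤^ 0≤c 10) (≤-trans (^-mono 0≤c c≤81/82 10) 81/82^10) 16)) 9/10^16

  -- Regrouped, the product is a Q-th power whose base is at most 1 by `decay-unit`: the factor 2 of
  -- each query is paid for by 160 units of the exponent k.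
  decay : ∀ {p q} → 0ℚ ≤ p → 0ℚ ≤ q → p ^ 40 * q ≤ 81/82 → ∀ Q →
          2ℚ ^ Q * (p ^ (40 ℕ.* (10 ℕ.* (16 ℕ.* Q))) * q ^ (10 ℕ.* (16 ℕ.* Q))) ≤ 1ℚ
  decay {p} {q} 0≤p 0≤q c≤81/82 Q = begin
    2ℚ ^ Q * (p ^ (40 ℕ.* k) * q ^ k)
      ≡⟨ cong (λ c → 2ℚ ^ Q * (c * q ^ k)) (^-* p 40 k) ⟩
    2ℚ ^ Q * ((p ^ 40) ^ k * q ^ k)
      ≡⟨ cong (2ℚ ^ Q *_) (sym (*-^ (p ^ 40) q k)) ⟩
    2ℚ ^ Q * (p ^ 40 * q) ^ k
      ≡⟨ cong (2ℚ ^ Q *_) (trans (^-* (p ^ 40 * q) 10 (16 ℕ.* Q)) (^-* ((p ^ 40 * q) ^ 10) 16 Q)) ⟩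
    2ℚ ^ Q * (((p ^ 40 * q) ^ 10) ^ 16) ^ Q
      ≡⟨ sym (*-^ 2ℚ (((p ^ 40 * q) ^ 10) ^ 16) Q) ⟩
    (2ℚ * ((p ^ 40 * q) ^ 10) ^ 16) ^ Q
      ≤⟨ ^-mono (0≤p*q (nonNegative⁻¹ 2ℚ) (0≤^ (0≤^ 0≤c 10) 16)) (decay-unit 0≤c c≤81/82) Q ⟩
    1ℚ ^ Q
      ≡⟨ 1^ Q ⟩
    1ℚ ∎
    where
    open ≤-Reasoning
    k = 10 ℕ.* (16 ℕ.* Q)
    0≤c : 0ℚ ≤ p ^ 40 * q
    0≤c = 0≤p*q (0≤^ 0≤p 40) 0≤q

  -- The query bound for a randomized mechanism.

  sumF-const : ∀ N p → sumF {N} (λ _ → p) ≡ ι N * p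
  sumF-const zero    p = sym (*-zeroˡ p)
  sumF-const (suc N) p = trans (cong (p +_) (sumF-const N p))
    (solve 2 (λ n p → p :+ n :* p := (con 1ℚ :+ n) :* p) refl (ι N) p)

  planted-const : ∀ {N} c p → planted {N} c (λ _ → p) ≡ ι N * p
  planted-const {N} c p = trans (ext (sumF-linear {N}) (λ i →
    trans (ext (𝔼-linear {N}) (λ D → trans (ext (𝔼-linear {N}) (λ z → 𝔼-const N p)) (𝔼-const N p))) (𝔼-const N p)))
    (sumF-const N p)

  -- Compares f and g on planted instances only, which is where `accepts`, `rejects` and the cost
  -- hypothesis give information.
  planted-mono : ∀ {N} c (f g : Inputs N → ℚ) → (∀ ω → f (instance-at c ω) ≤ g (instance-at c ω)) → planted c f ≤ planted c g
  planted-mono {N} c _ _ f≤g = mono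
    (⊗-linear sumF-linear (⊗-linear (𝔼-linear {N}) (⊗-linear (𝔼-linear {N}) (𝔼-linear {N})))) f≤g

  unplanted≤1 : ∀ {N} {f : Inputs N → ℚ} → (∀ xy → f xy ≤ 1ℚ) → unplanted f ≤ 1ℚ
  unplanted≤1 {N} f≤1 = 𝔼≤ {N} (λ D → 𝔼≤ {N} (λ z → 𝔼≤ {N} (λ z′ → f≤1 _)))

  ⅓ ⅔ 1/30 : ℚ
  ⅓    = ℤ.+ 1 / 3
  ⅔    = ℤ.+ 2 / 3
  1/30 = ℤ.+ 1 / 30

  module _ {n m N : ℕ} {batch : Fin n → Fin m} (enc : Inputs N → Profile n)
           (local : ∀ {q} → AllowedQuery batch q → Local enc q)
           (R : Randomized n) (allowed : AllowedRandomized batch R)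
           (accepts : ∀ ω → ⅔ ≤ probOutput R (enc (instance-at false ω)) true)
           (rejects : ∀ ω → ⅔ ≤ probOutput R (enc (instance-at true ω)) false)
    where

    private
      L = support R

      mix : (Tree n → ℚ) → ℚ
      mix = mixture L

      out : Tree n → Inputs N → ℚ
      out t xy = ind (output t (enc xy))

      acc : ℕ → Tree n → Inputs N → ℚ
      acc K t xy = ind (accept K t (enc xy))

      mix-mono : ∀ {f g} → (∀ t → f t ≤ g t) → mix f ≤ mix g
      mix-mono f≤g = mixture-mono L (nonneg R) (λ {_} {t} _ → f≤g t)

      mix-const : ∀ c → mix (λ _ → c) ≡ c
      mix-const c = trans (mixture-const L c) (trans (cong (_* c) (total R)) (*-identityˡ c))

    mix-disjoint : ι N * ⅔ ≤ mix (λ t → planted false (out t))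
    mix-disjoint = begin
      ι N * ⅔
        ≡⟨ sym (planted-const {N} false ⅔) ⟩
      planted {N} false (λ _ → ⅔)
        ≤⟨ planted-mono false (λ _ → ⅔) (λ xy → mix (λ t → out t xy)) (λ ω → ≤-trans (accepts ω) (≤-reflexive (probOutput-true R _))) ⟩
      planted false (λ xy → mix (λ t → out t xy))
        ≡⟨ mixture-swap (planted-linear false) L out ⟩
      mix (λ t → planted false (out t)) ∎
      where open ≤-Reasoning

    mix-intersecting : mix (λ t → planted true (out t)) ≤ ι N * ⅓
    mix-intersecting = begin
      mix (λ t → planted true (out t))
        ≡⟨ sym (mixture-swap (planted-linear true) L out) ⟩
      planted true (λ xy → mix (λ t → out t xy))
        ≤⟨ planted-mono true (λ xy → mix (λ t → out t xy)) (λ _ → ⅓) (λ ω → ≤-trans (≤-reflexive (sym (probOutput-true R _))) (complement (rejects ω) (probOutput-total R _))) ⟩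
      planted {N} true (λ _ → ⅓)
        ≡⟨ planted-const {N} true ⅓ ⟩
      ι N * ⅓ ∎
      where
      open ≤-Reasoning
      complement : ∀ {p q} → ⅔ ≤ q → p + q ≡ 1ℚ → p ≤ ⅓
      complement {p} {q} ⅔≤q p+q≡1 = begin
        p               ≡⟨ solve 1 (λ p → p := p :+ con ⅔ :- con ⅔) refl p ⟩
        p + ⅔ - ⅔       ≤⟨ +-monoˡ-≤ (- ⅔) (+-monoʳ-≤ p ⅔≤q) ⟩
        p + q - ⅔       ≡⟨ cong (_- ⅔) p+q≡1 ⟩
        1ℚ - ⅔          ≡⟨⟩
        ⅓               ∎

    module _ (k K : ℕ) where

      -- `accept-bound` is averaged over the trees. Intersecting inputs are accepted by the
      -- truncated trees no more than by the full ones, and the unplanted mass is at most 1.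
      mix-accept : mix (λ t → planted false (acc K t)) ≤ ι N * ⅓ + 8ℚ * (ι k + 2ℚ ^ K * η N k)
      mix-accept = begin
        mix (λ t → planted false (acc K t))
          ≤⟨ mixture-mono L (nonneg R) (λ {_} {t} t∈ → ≤-trans (Bounded.bound (accept-bound enc local k (allowed t∈) K))
               (+-mono-≤ (mono (planted-linear true) (λ xy → accept≤output K t (enc xy)))
                 (*-monoˡ-≤ (nonNegative⁻¹ 8ℚ) (+-monoˡ-≤ e (*-monoˡ-≤ (0≤ι k) (unplanted≤1 {f = acc K t} (λ xy → ind≤1 (accept K t (enc xy))))))))) ⟩
        mix (λ t → planted true (out t) + 8ℚ * (ι k * 1ℚ + e))
          ≡⟨ trans (mixture-add L (λ t → planted true (out t)) _) (cong (mix (λ t → planted true (out t)) +_) (mix-const _)) ⟩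
        mix (λ t → planted true (out t)) + 8ℚ * (ι k * 1ℚ + e)
          ≤⟨ +-monoˡ-≤ (8ℚ * (ι k * 1ℚ + e)) mix-intersecting ⟩
        ι N * ⅓ + 8ℚ * (ι k * 1ℚ + e)
          ≡⟨ cong (λ p → ι N * ⅓ + 8ℚ * (p + e)) (*-identityʳ (ι k)) ⟩
        ι N * ⅓ + 8ℚ * (ι k + e) ∎
        where
        open ≤-Reasoning
        e = 2ℚ ^ K * η N k

      -- Markov: K + 1 times the acceptance lost to truncation is at most the expected cost, whose
      -- total over the disjoint instances is at most N C.
      cost-tradeoff : ∀ C → (∀ ω → expectedCost R (enc (instance-at false ω)) ≤ C) →
        ι (suc K) * (ι N * ⅔) ≤ ι (suc K) * (ι N * ⅓ + 8ℚ * (ι k + 2ℚ ^ K * η N k)) + ι N * C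
      cost-tradeoff C cost≤C = begin
        u * (ι N * ⅔)
          ≤⟨ *-monoˡ-≤ (0≤ι (suc K)) mix-disjoint ⟩
        u * mix (λ t → planted false (out t))
          ≡⟨ sym (mixture-scale L u (λ t → planted false (out t))) ⟩
        mix (λ t → u * planted false (out t))
          ≤⟨ mix-mono (λ t → ≤-trans (≤-reflexive (sym (scale (planted-linear false) u (out t))))
               (≤-trans (mono (planted-linear false) (λ xy → output≤accept K t (enc xy)))
               (≤-reflexive (trans (add (planted-linear false) (λ xy → u * acc K t xy) (λ xy → ι (cost t (enc xy))))
                  (cong (_+ planted false (λ xy → ι (cost t (enc xy)))) (scale (planted-linear false) u (acc K t))))))) ⟩
        mix (λ t → u * planted false (acc K t) + planted false (λ xy → ι (cost t (enc xy))))
          ≡⟨ trans (mixture-add L (λ t → u * planted false (acc K t)) _) (cong₂ _+_ (mixture-scale L u (λ t → planted false (acc K t)))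
               (sym (mixture-swap (planted-linear false) L (λ t xy → ι (cost t (enc xy)))))) ⟩
        u * mix (λ t → planted false (acc K t)) + planted false (λ xy → mix (λ t → ι (cost t (enc xy))))
          ≤⟨ +-mono-≤ (*-monoˡ-≤ (0≤ι (suc K)) mix-accept)
               (≤-trans (planted-mono false (λ xy → mix (λ t → ι (cost t (enc xy)))) (λ _ → C) (λ ω → ≤-trans (≤-reflexive (sum-cong (λ (w , t) → cong (w *_) (ι≡/1 (cost t _))) L)) (cost≤C ω)))
                        (≤-reflexive (planted-const {N} false C))) ⟩
        u * (ι N * ⅓ + 8ℚ * (ι k + 2ℚ ^ K * η N k)) + ι N * C ∎
        where
        open ≤-Reasoning
        u = ι (suc K)

    -- With k = 160 Q and N = 6400 Q, the advantage N/3 exceeds the corruption loss 8k = N/5 plus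
    -- the truncation loss N/30 by 640 Q, while the remaining error is only 8 · 40 = 320.
    expensive : ∀ Q′ → N ≡ 40 ℕ.* (10 ℕ.* (16 ℕ.* suc Q′)) →
      (∀ ω → expectedCost R (enc (instance-at false ω)) ≤ ι (suc Q′) * 1/30) → ⊥
    expensive Q′ N≡ cheap = absurd (*-cancelˡ-≤-pos u {{positive (<-≤-trans (positive⁻¹ 1ℚ) 1≤u)}} (begin
        u * (6400ℚ * w * ⅔)
          ≡⟨ cong (λ p → u * (p * ⅔)) (sym ιN) ⟩
        u * (ι N * ⅔)
          ≤⟨ cost-tradeoff k Q (w * 1/30) cheap ⟩
        u * (ι N * ⅓ + 8ℚ * (ι k + 2ℚ ^ Q * η N k)) + ι N * (w * 1/30)
          ≡⟨ cong₂ (λ p q → u * (p * ⅓ + 8ℚ * (q + 2ℚ ^ Q * η N k)) + p * (w * 1/30)) ιN ιk ⟩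
        u * (6400ℚ * w * ⅓ + 8ℚ * (160ℚ * w + 2ℚ ^ Q * η N k)) + 6400ℚ * w * (w * 1/30)
          -- Raising one `w` in the cost term to `u` makes `u` a common factor, which is then
          -- cancelled.
          ≤⟨ +-mono-≤ (*-monoˡ-≤ (0≤ι (suc Q)) (+-monoʳ-≤ (6400ℚ * w * ⅓) (*-monoˡ-≤ (nonNegative⁻¹ 8ℚ) (+-monoʳ-≤ (160ℚ * w) small))))
               (*-monoˡ-≤ (0≤p*q (nonNegative⁻¹ 6400ℚ) (0≤ι Q)) (*-monoʳ-≤ (nonNegative⁻¹ 1/30) w≤u)) ⟩
        u * (6400ℚ * w * ⅓ + 8ℚ * (160ℚ * w + 40ℚ)) + 6400ℚ * w * (u * 1/30)
          ≡⟨ solve 2 (λ u w → u :* (con 6400ℚ :* w :* con ⅓ :+ con 8ℚ :* (con 160ℚ :* w :+ con 40ℚ)) :+ con 6400ℚ :* w :* (u :* con 1/30)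
               := u :* (con 6400ℚ :* w :* con ⅓ :+ con 8ℚ :* (con 160ℚ :* w :+ con 40ℚ) :+ con 6400ℚ :* w :* con 1/30)) refl u w ⟩
        u * (6400ℚ * w * ⅓ + 8ℚ * (160ℚ * w + 40ℚ) + 6400ℚ * w * 1/30) ∎))
      where
      open ≤-Reasoning
      Q = suc Q′
      k = 10 ℕ.* (16 ℕ.* Q)
      6400ℚ 160ℚ 640ℚ 320ℚ : ℚ
      6400ℚ = ℤ.+ 6400 / 1
      160ℚ = ℤ.+ 160 / 1
      640ℚ = ℤ.+ 640 / 1
      320ℚ = ℤ.+ 320 / 1
      u = ι (suc Q)
      w = ι Q

      ιk : ι k ≡ 160ℚ * w
      ιk = trans (ι-* 10 (16 ℕ.* Q)) (trans (cong (ι 10 *_) (ι-* 16 Q)) (sym (*-assoc (ι 10) (ι 16) w)))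

      ιN : ι N ≡ 6400ℚ * w
      ιN = trans (cong ι N≡) (trans (ι-* 40 k) (trans (cong (ι 40 *_) ιk) (sym (*-assoc (ι 40) 160ℚ w))))

      w≤u : w ≤ u
      w≤u = ≤-trans (≤-reflexive (sym (+-identityˡ w))) (+-monoˡ-≤ w (nonNegative⁻¹ 1ℚ))

      1≤w : 1ℚ ≤ w
      1≤w = p+x≤q⇒p≤q ≤-refl (0≤ι Q′)

      1≤u : 1ℚ ≤ u
      1≤u = ≤-trans 1≤w w≤u

      small : 2ℚ ^ Q * η N k ≤ 40ℚ
      small = begin
        2ℚ ^ Q * (40ℚ * (cosh ^ N * r⁻¹ ^ k))
          ≡⟨ solve 3 (λ a c d → a :* (con 40ℚ :* (c :* d)) := con 40ℚ :* (a :* (c :* d))) refl (2ℚ ^ Q) (cosh ^ N) (r⁻¹ ^ k) ⟩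
        40ℚ * (2ℚ ^ Q * (cosh ^ N * r⁻¹ ^ k))
          ≤⟨ *-monoˡ-≤ (nonNegative⁻¹ 40ℚ) (subst (λ N → 2ℚ ^ Q * (cosh ^ N * r⁻¹ ^ k) ≤ 1ℚ) (sym N≡) (decay (nonNegative⁻¹ cosh) 0≤r⁻¹ (*-monoʳ-≤ 0≤r⁻¹ cosh^40) Q)) ⟩
        40ℚ * 1ℚ
          ≡⟨⟩
        40ℚ ∎

      absurd : 6400ℚ * w * ⅔ ≤ 6400ℚ * w * ⅓ + 8ℚ * (160ℚ * w + 40ℚ) + 6400ℚ * w * 1/30 → ⊥
      absurd le = toWitnessFalse {a? = 640ℚ ≤? 320ℚ} _ (begin
        640ℚ
          ≡⟨⟩
        640ℚ * 1ℚ
          ≤⟨ *-monoˡ-≤ (nonNegative⁻¹ 640ℚ) 1≤w ⟩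
        640ℚ * w
          ≡⟨ solve 1 (λ w → con 640ℚ :* w := con 6400ℚ :* w :* con ⅔
               :+ (:- (con 6400ℚ :* w :* con ⅓ :+ con 8ℚ :* (con 160ℚ :* w) :+ con 6400ℚ :* w :* con 1/30))) refl w ⟩
        6400ℚ * w * ⅔ + c
          ≤⟨ +-monoˡ-≤ c le ⟩
        6400ℚ * w * ⅓ + 8ℚ * (160ℚ * w + 40ℚ) + 6400ℚ * w * 1/30 + c
          ≡⟨ solve 1 (λ w → con 6400ℚ :* w :* con ⅓ :+ con 8ℚ :* (con 160ℚ :* w :+ con 40ℚ) :+ con 6400ℚ :* w :* con 1/30
               :+ (:- (con 6400ℚ :* w :* con ⅓ :+ con 8ℚ :* (con 160ℚ :* w) :+ con 6400ℚ :* w :* con 1/30)) := con 320ℚ) refl w ⟩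
        320ℚ ∎)
        where c = - (6400ℚ * w * ⅓ + 8ℚ * (160ℚ * w) + 6400ℚ * w * 1/30)

open import Data.Nat using (_≤_; _<_; z≤n; s≤s; _+_; _*_; _∸_; _<?_; _≤?_)
open import Data.Rational using (ℚ; 0ℚ)
open Disjointness using (ι; ι≡/1; ι-*; ι-mono; *-monoˡ-≤; ∁; _∧ᵛ_; Inputs; Samples; instance-at; Local; ⅔; 1/30; expensive)

-- Preference lists from numerical levels.

AllPairs-before : ∀ {A : Set} {R : A → A → Set} ys {b c : A} {zs} → AllPairs R (ys ++ b ∷ zs) → c ∈ zs → R b c
AllPairs-before []       (p ∷ _)  c∈ = All.lookup p c∈
AllPairs-before (_ ∷ ys) (_ ∷ ps) c∈ = AllPairs-before ys ps c∈

AllPairs-after : ∀ {A : Set} {R : A → A → Set} ys {b c : A} {zs} → AllPairs R (ys ++ b ∷ zs) → c ∈ ys → R c b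
AllPairs-after (_ ∷ ys) (p ∷ _)  (here refl) = All.lookup p (∈-++⁺ʳ ys (here refl))
AllPairs-after (_ ∷ ys) (_ ∷ ps) (there c∈)  = AllPairs-after ys ps c∈

module _ {n : ℕ} (level : Fin n → ℕ) (a : Fin n) where

  private
    order : DecTotalOrder _ _ _
    order = On.decTotalOrder ℕ.≤-decTotalOrder level

    open Data.List.Sort order using (sort; sort-↭; sort-↗)

    others : List (Fin n)
    others = filter (λ b → ¬? (b Fin.≟ a)) (allFin n)

  -- Agents of equal level come in whatever order the sort leaves them. Hence an earlier place
  -- yields only ≤ between levels, and < is required to conclude an earlier place.
  ranking : List (Fin n)
  ranking = sort others

  ranking-unique : Unique ranking
  ranking-unique = Perm.Unique-resp-↭ (setoid (Fin n)) (↭⇒↭ₛ (↭-sym (sort-↭ others)))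
    (Unique.filter⁺ _ (Unique.allFin⁺ n))

  ∈-ranking⁺ : ∀ {b} → b ≢ a → b ∈ ranking
  ∈-ranking⁺ {b} b≢a = ∈-resp-↭ (↭-sym (sort-↭ others)) (∈-filter⁺ _ (∈-allFin b) b≢a)

  ∈-ranking⁻ : ∀ {b} → b ∈ ranking → b ≢ a
  ∈-ranking⁻ b∈ = proj₂ (∈-filter⁻ (λ b → ¬? (b Fin.≟ a)) {xs = allFin n} (∈-resp-↭ (sort-↭ others) b∈))

  ranking-sorted : AllPairs (λ b c → level b ≤ level c) ranking
  ranking-sorted = Sorted⇒AllPairs (DecTotalOrder.totalOrder order) (sort-↗ others)

  before⇒≤ : ∀ {b c} → Before ranking b c → level b ≤ level c
  before⇒≤ (ys , zs , eq , c∈zs) = AllPairs-before ys (subst (AllPairs _) eq ranking-sorted) c∈zs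

  <⇒before : ∀ {b c} → b ≢ a → c ≢ a → level b < level c → Before ranking b c
  <⇒before {b} {c} b≢a c≢a b<c with ∈-∃++ (∈-ranking⁺ b≢a)
  ... | ys , zs , eq with ∈-++⁻ ys (subst (c ∈_) eq (∈-ranking⁺ c≢a))
  ...   | inj₁ c∈ys         = contradiction (AllPairs-after ys (subst (AllPairs _) eq ranking-sorted) c∈ys) (ℕ.<⇒≱ b<c)
  ...   | inj₂ (here refl)  = contradiction b<c (ℕ.<-irrefl refl)
  ...   | inj₂ (there c∈zs) = ys , zs , eq , c∈zs

rankingProfile : ∀ {n} → (Fin n → Fin n → ℕ) → Profile n
rankingProfile level a = ranking (level a) a

rankingProfile-valid : ∀ {n} (level : Fin n → Fin n → ℕ) → ValidProfile (rankingProfile level)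
rankingProfile-valid level a =
  ranking-unique (level a) a , λ b → mk⇔ (∈-ranking⁻ (level a) a) (∈-ranking⁺ (level a) a)

-- The roommates gadget.

-- A row is a pair of mates. The r rows inj₂ (inj₁ (suc _)) are padding.
Row : ℕ → ℕ → Set
Row m r = Fin m ⊎ (Fin (suc r) ⊎ Fin m)

Role : ℕ → ℕ → Set
Role m r = Row m r × Bool

-- The Boolean tags are chosen for `roleIndex`, which lists the `false` roles before the `true`
-- ones: every alice comes first and every bob last.
pattern alice i  = inj₁ i , false
pattern alice′ i = inj₁ i , true
pattern bob j    = inj₂ (inj₂ j) , true
pattern bob′ j   = inj₂ (inj₂ j) , false
pattern hub      = inj₂ (inj₁ zero) , false
pattern hub′     = inj₂ (inj₁ zero) , true

module _ {m r : ℕ} where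

  infix 4 _≟ᴿ_

  _≟ᴿ_ : DecidableEquality (Role m r)
  _≟ᴿ_ = ≡-dec (Sum.≡-dec Fin._≟_ (Sum.≡-dec Fin._≟_ Fin._≟_)) Bool._≟_

  mate : Role m r → Role m r
  mate (w , b) = w , not b

  mate-involutive : ∀ p → mate (mate p) ≡ p
  mate-involutive (w , b) = cong (w ,_) (Bool.not-involutive b)

  mate-no-fixed : ∀ p → mate p ≢ p
  mate-no-fixed (w , false) ()
  mate-no-fixed (w , true)  ()

  -- Together with `hubWants` and the mate levels this is a cyclic triple: alice′ puts hub above
  -- hub′, hub puts hub′ above alice′, and hub′ puts alice′ above hub. It is dormant while alice′
  -- has her mate, whom she likes best.
  fallback : Role m r → Role m r → ℕ
  fallback (alice′ _) hub        = 2
  fallback (alice′ _) hub′       = 3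
  fallback hub        (alice′ _) = 2
  fallback _          _          = 4

  2≤fallback : ∀ p s → 2 ≤ fallback p s
  2≤fallback (alice _)  _                        = s≤s (s≤s z≤n)
  2≤fallback (alice′ _) (inj₁ _ , _)             = s≤s (s≤s z≤n)
  2≤fallback (alice′ _) hub                      = s≤s (s≤s z≤n)
  2≤fallback (alice′ _) hub′                     = s≤s (s≤s z≤n)
  2≤fallback (alice′ _) (inj₂ (inj₁ (suc _)) , _) = s≤s (s≤s z≤n)
  2≤fallback (alice′ _) (inj₂ (inj₂ _) , _)      = s≤s (s≤s z≤n)
  2≤fallback hub        (alice _)                = s≤s (s≤s z≤n)
  2≤fallback hub        (alice′ _)               = s≤s (s≤s z≤n)
  2≤fallback hub        (inj₂ _ , _)             = s≤s (s≤s z≤n)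
  2≤fallback hub′       _                        = s≤s (s≤s z≤n)
  2≤fallback (inj₂ (inj₁ (suc _)) , _) _         = s≤s (s≤s z≤n)
  2≤fallback (inj₂ (inj₂ _) , _) _               = s≤s (s≤s z≤n)

  aliceWants bobWants : (Fin m → Fin m → Bool) → Fin m → Role m r → Bool
  aliceWants x i (bob j)   = x i j
  aliceWants x i _         = false
  bobWants   y j (alice i) = y i j
  bobWants   y j _         = false

  hubWants : Role m r → Bool
  hubWants (alice′ _) = true
  hubWants _          = false

  module Gadget (x y : Fin m → Fin m → Bool) where

    wants : Role m r → Role m r → Bool
    wants (alice i) = aliceWants x i
    wants (bob j)   = bobWants y j
    wants hub′      = hubWants
    wants _         = λ _ → false

    level : Role m r → Role m r → ℕ
    level p s = if wants p s then 0 else if does (s ≟ᴿ mate p) then 1 else fallback p s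

    level-wanted : ∀ {p s} → wants p s ≡ true → level p s ≡ 0
    level-wanted w rewrite w = refl

    level-mate≤1 : ∀ p → level p (mate p) ≤ 1
    level-mate≤1 p with wants p (mate p)
    ... | true  = z≤n
    ... | false rewrite dec-true (mate p ≟ᴿ mate p) refl = s≤s z≤n

    level-mate : ∀ p → wants p (mate p) ≡ false → level p (mate p) ≡ 1
    level-mate p w rewrite w | dec-true (mate p ≟ᴿ mate p) refl = refl

    level-fallback : ∀ {p s} → wants p s ≡ false → s ≢ mate p → level p s ≡ fallback p s
    level-fallback {p} {s} w s≢ rewrite w | dec-false (s ≟ᴿ mate p) s≢ = refl

    2≤level : ∀ {p s} → wants p s ≡ false → s ≢ mate p → 2 ≤ level p s
    2≤level {p} {s} w s≢ = subst (2 ≤_) (sym (level-fallback w s≢)) (2≤fallback p s)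

    data Wants : Role m r → Role m r → Set where
      alice-bob  : ∀ {i j} → x i j ≡ true → Wants (alice i) (bob j)
      bob-alice  : ∀ {i j} → y i j ≡ true → Wants (bob j) (alice i)
      hub-alice′ : ∀ {i} → Wants hub′ (alice′ i)

    wants⇒Wants : ∀ p s → wants p s ≡ true → Wants p s
    wants⇒Wants (alice i)  (bob j)                  w = alice-bob w
    wants⇒Wants (alice i)  (inj₁ _ , _)             ()
    wants⇒Wants (alice i)  (inj₂ (inj₁ _) , _)      ()
    wants⇒Wants (alice i)  (bob′ _)                 ()
    wants⇒Wants (bob j)    (alice i)                w = bob-alice w
    wants⇒Wants (bob j)    (alice′ i)               ()
    wants⇒Wants (bob j)    (inj₂ _ , _)             ()
    wants⇒Wants hub′       (alice′ i)               w = hub-alice′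
    wants⇒Wants hub′       (alice i)                ()
    wants⇒Wants hub′       (inj₂ _ , _)             ()

    not-wanted : ∀ {p s} → ¬ Wants p s → wants p s ≡ false
    not-wanted {p} {s} ¬w = Bool.¬-not (¬w ∘ wants⇒Wants p s)

    -- Someone other than the mate is ranked as high as the mate only if wanted, so a blocking pair
    -- wants each other. The wish of hub′ is never returned, and a mutual wish of alice and bob is a
    -- common 1.
    disjoint-no-block : (∀ i j → x i j ≡ true → y i j ≡ true → ⊥) → ∀ p s → s ≢ mate p → p ≢ mate s →
      level p s ≤ level p (mate p) → level s p ≤ level s (mate s) → ⊥
    disjoint-no-block disjoint p s s≢ p≢ p→s s→p =
      no-mutual (must-want s≢ p→s) (must-want p≢ s→p)
      where
      must-want : ∀ {p s} → s ≢ mate p → level p s ≤ level p (mate p) → Wants p s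
      must-want {p} {s} s≢ le with wants p s in w
      ... | true  = wants⇒Wants p s w
      ... | false = contradiction (ℕ.≤-trans (2≤level w s≢) (ℕ.≤-trans (ℕ.≤-reflexive unfold) (ℕ.≤-trans le (level-mate≤1 p)))) λ { (s≤s ()) }
        where
        unfold : level p s ≡ (if does (s ≟ᴿ mate p) then 1 else fallback p s)
        unfold rewrite w = refl

      no-mutual : ∀ {p s} → Wants p s → Wants s p → ⊥
      no-mutual (alice-bob xᵢⱼ) (bob-alice yᵢⱼ) = disjoint _ _ xᵢⱼ yᵢⱼ
      no-mutual (bob-alice yᵢⱼ) (alice-bob xᵢⱼ) = disjoint _ _ xᵢⱼ yᵢⱼ

    module Intersecting
      (i₀ j₀ : Fin m) (x₀ : x i₀ j₀ ≡ true) (y₀ : y i₀ j₀ ≡ true)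
      (only : ∀ {i j} → x i j ≡ true → y i j ≡ true → i ≡ i₀ × j ≡ j₀)
      (π : Role m r → Role m r) (π-involutive : ∀ p → π (π p) ≡ p)
      (stable : ∀ p s → p ≢ s → level p s < level p (π p) → level s p < level s (π s) → ⊥)
      where

      flip : ∀ {p s} → π p ≡ s → π s ≡ p
      flip {p} refl = π-involutive p

      -- Otherwise p and its mate block: both have partners of level at least 2 and rank each other
      -- at level at most 1.
      settled : ∀ p → (∀ s → ¬ Wants (mate p) s) → Wants p (π p) ⊎ π p ≡ mate p
      settled p mate-fixed with wants p (π p) in w | π p ≟ᴿ mate p
      ... | true  | _      = inj₁ (wants⇒Wants p (π p) w)
      ... | false | yes eq = inj₂ eq
      ... | false | no  ≢  = ⊥-elim (stable p (mate p) (mate-no-fixed p ∘ sym)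
        (ℕ.≤-<-trans (level-mate≤1 p) (2≤level w ≢))
        (subst (λ p′ → level (mate p) p′ < level (mate p) (π (mate p))) (mate-involutive p)
          (ℕ.≤-<-trans (level-mate≤1 (mate p))
            (2≤level (not-wanted (mate-fixed _)) (λ eq → ≢ (flip (trans eq (mate-involutive p))))))))

      alice-settled : ∀ i → (∃ λ j → π (alice i) ≡ bob j × x i j ≡ true) ⊎ π (alice i) ≡ alice′ i
      alice-settled i with π (alice i) | settled (alice i) (λ s ())
      ... | _ | inj₁ (alice-bob xᵢⱼ) = inj₁ (_ , refl , xᵢⱼ)
      ... | _ | inj₂ eq              = inj₂ eq

      bob-settled : ∀ j → (∃ λ i → π (bob j) ≡ alice i × y i j ≡ true) ⊎ π (bob j) ≡ bob′ j
      bob-settled j with π (bob j) | settled (bob j) (λ s ())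
      ... | _ | inj₁ (bob-alice yᵢⱼ) = inj₁ (_ , refl , yᵢⱼ)
      ... | _ | inj₂ eq              = inj₂ eq

      -- Both partners have left their mates, so each must want the other, which exhibits a common
      -- 1.
      cross-pair : ∀ {i j} → π (alice i) ≡ bob j → i ≡ i₀ × j ≡ j₀
      cross-pair {i} {j} eq with alice-settled i | bob-settled j
      ... | inj₂ eq′ | _ = contradiction (trans (sym eq) eq′) λ ()
      ... | inj₁ _ | inj₂ eq′ = contradiction (trans (sym (flip eq)) eq′) λ ()
      ... | inj₁ (j′ , eq₁ , xᵢⱼ) | inj₁ (i′ , eq₂ , yᵢⱼ) with trans (sym eq) eq₁ | trans (sym (flip eq)) eq₂
      ...   | refl | refl = only xᵢⱼ yᵢⱼ

      -- If either of them leaves the mate, `cross-pair` fixes the new partner. If neither does,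
      -- they block, each being wanted by the other.
      alice₀-bob₀ : π (alice i₀) ≡ bob j₀
      alice₀-bob₀ with alice-settled i₀ | bob-settled j₀
      ... | inj₁ (j , eq , _) | _ = trans eq (cong (λ j → bob j) (proj₂ (cross-pair eq)))
      ... | inj₂ _ | inj₁ (i , eq , _) = flip (trans eq (cong (λ i → alice i) (proj₁ (cross-pair (flip eq)))))
      ... | inj₂ eq | inj₂ eq′ = ⊥-elim (stable (alice i₀) (bob j₀) (λ ())
        (subst₂ _<_ (sym (level-wanted {alice i₀} {bob j₀} x₀)) (trans (sym (level-mate (alice i₀) refl)) (cong (level (alice i₀)) (sym eq))) (s≤s z≤n))
        (subst₂ _<_ (sym (level-wanted {bob j₀} {alice i₀} y₀)) (trans (sym (level-mate (bob j₀) refl)) (cong (level (bob j₀)) (sym eq′))) (s≤s z≤n)))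

      alice′-partner : ∀ {i s} → i ≢ i₀ → π (alice′ i) ≡ s → s ≡ alice i
      alice′-partner {i} i≢i₀ eq with alice-settled i
      ... | inj₁ (_ , eq′ , _) = contradiction (proj₁ (cross-pair eq′)) i≢i₀
      ... | inj₂ eq′ = trans (sym eq) (flip eq′)

      -- Every other alice′ is held by her mate. The bit b covers hub and hub′ at once.
      hub-partner : ∀ {b i} → π (inj₂ (inj₁ zero) , b) ≡ alice′ i → i ≡ i₀
      hub-partner {b} {i} eq with i Fin.≟ i₀
      ... | yes i≡i₀ = i≡i₀
      ... | no  i≢i₀ = contradiction (alice′-partner i≢i₀ (flip eq)) λ ()

      fourth : fallback hub (π hub) ≡ 4 ⊎ ∃ λ i → π hub ≡ alice′ i
      fourth with π hub
      ... | alice _      = inj₁ refl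
      ... | alice′ i     = inj₂ (i , refl)
      ... | inj₂ _ , _   = inj₁ refl

      last-resort : ∀ s → s ≢ hub → s ≢ hub′ → fallback (alice′ i₀) s ≡ 4
      last-resort (inj₁ _ , _)              _  _   = refl
      last-resort hub                       ≢h _   = contradiction refl ≢h
      last-resort hub′                      _  ≢h′ = contradiction refl ≢h′
      last-resort (inj₂ (inj₁ (suc _)) , _) _  _   = refl
      last-resort (inj₂ (inj₂ _) , _)       _  _   = refl

      -- With alice i₀ taken by bob j₀, the roles alice′ i₀, hub and hub′ form an odd party.
      unstable : ⊥
      unstable with π (alice′ i₀) ≟ᴿ hub | π (alice′ i₀) ≟ᴿ hub′
      -- hub left its mate for a worse partner, and hub′ has neither its mate nor a wanted partner:
      -- they block.
      ... | yes eq | _ = stable hub hub′ (λ ())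
        (subst₂ _<_ (sym (level-mate hub refl)) (sym (trans (cong (level hub) (flip eq)) (level-fallback {hub} {alice′ i₀} refl (λ ())))) (s≤s (s≤s z≤n)))
        (subst (_< level hub′ (π hub′)) (sym (level-mate hub′ refl)) (2≤level (not-wanted unwanted) ≢hub))
        where
        unwanted : ¬ Wants hub′ (π hub′)
        unwanted w with π hub′ in eq′ | w
        ... | _ | hub-alice′ with hub-partner eq′
        ...   | refl = contradiction (trans (sym eq) (flip eq′)) λ ()
        ≢hub : π hub′ ≢ hub
        ≢hub eq′ = contradiction (trans (sym (flip eq)) (flip eq′)) λ ()
      -- alice′ i₀ ranks hub (2) above hub′ (3), and hub, with neither its mate nor an alice′, is at
      -- level 4.
      ... | no _ | yes eq = stable (alice′ i₀) hub (λ ())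
        (subst₂ _<_ (sym (level-fallback {alice′ i₀} {hub} refl (λ ()))) (sym (trans (cong (level (alice′ i₀)) eq) (level-fallback {alice′ i₀} {hub′} refl (λ ())))) ℕ.≤-refl)
        (subst₂ _<_ (sym (level-fallback {hub} {alice′ i₀} refl (λ ()))) (sym (trans (level-fallback {hub} {π hub} refl ≢hub′) four)) (s≤s (s≤s (s≤s z≤n))))
        where
        ≢hub′ : π hub ≢ hub′
        ≢hub′ eq′ = contradiction (trans (sym (flip eq)) (flip eq′)) λ ()
        four : fallback hub (π hub) ≡ 4
        four with fourth
        ... | inj₁ four = four
        ... | inj₂ (i , eq′) with hub-partner eq′
        ...   | refl = contradiction (trans (sym eq) (flip eq′)) λ ()
      -- alice′ i₀ has lost her mate and is at level 4, below hub′ (3), and hub′ wants her but has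
      -- no wanted partner.
      ... | no ≢hub | no ≢hub′ = stable (alice′ i₀) hub′ (λ ())
        (subst₂ _<_ (sym (level-fallback {alice′ i₀} {hub′} refl (λ ())))
          (sym (trans (level-fallback {alice′ i₀} {π (alice′ i₀)} refl ≢mate) (last-resort _ ≢hub ≢hub′))) ℕ.≤-refl)
        (subst (0 <_) (sym (cong (λ b → if b then 0 else if does (π hub′ ≟ᴿ hub) then 1 else fallback hub′ (π hub′)) (not-wanted unwanted))) positive)
        where
        ≢mate : π (alice′ i₀) ≢ alice i₀
        ≢mate eq = contradiction (trans (sym (flip eq)) alice₀-bob₀) λ ()
        unwanted : ¬ Wants hub′ (π hub′)
        unwanted w with π hub′ in eq′ | w
        ... | _ | hub-alice′ with hub-partner eq′
        ...   | refl = ≢hub′ (flip eq′)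
        positive : 0 < (if does (π hub′ ≟ᴿ hub) then 1 else fallback hub′ (π hub′))
        positive with does (π hub′ ≟ᴿ hub)
        ... | true  = s≤s z≤n
        ... | false = s≤s z≤n

  open Gadget using (level) public

  -- Only the wishes of a bob mention y, so for any other role both sides compute to the same
  -- function. Equality as functions makes the sorted lists equal by congruence.
  level-unless-bob : ∀ {x y y′} p → (∀ j → p ≢ bob j) → level x y p ≡ level x y′ p
  level-unless-bob (inj₁ _ , false)             _    = refl
  level-unless-bob (inj₁ _ , true)              _    = refl
  level-unless-bob (inj₂ (inj₁ zero) , false)   _    = refl
  level-unless-bob (inj₂ (inj₁ zero) , true)    _    = refl
  level-unless-bob (inj₂ (inj₁ (suc _)) , _)    _    = refl
  level-unless-bob (inj₂ (inj₂ _) , false)      _    = refl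
  level-unless-bob (bob j)                      ≢bob = contradiction refl (≢bob j)

  level-unless-alice : ∀ {x x′ y} p → (∀ i → p ≢ alice i) → level x y p ≡ level x′ y p
  level-unless-alice (alice i)                    ≢alice = contradiction refl (≢alice i)
  level-unless-alice (inj₁ _ , true)              _      = refl
  level-unless-alice (inj₂ (inj₁ zero) , false)   _      = refl
  level-unless-alice (inj₂ (inj₁ zero) , true)    _      = refl
  level-unless-alice (inj₂ (inj₁ (suc _)) , _)    _      = refl
  level-unless-alice (inj₂ (inj₂ _) , false)      _      = refl
  level-unless-alice (inj₂ (inj₂ _) , true)       _      = refl

-- The gadget as a preference profile.

module _ {m r n : ℕ} (to : Fin n → Role m r) where

  gadgetProfile : (x y : Fin m → Fin m → Bool) → Profile n
  gadgetProfile x y = rankingProfile (λ a b → level x y (to a) (to b))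

  gadgetProfile-valid : ∀ x y → ValidProfile (gadgetProfile x y)
  gadgetProfile-valid x y = rankingProfile-valid (λ a b → level x y (to a) (to b))

  gadgetProfile-unless-bob : ∀ x y y′ a → (∀ j → to a ≢ bob j) → gadgetProfile x y a ≡ gadgetProfile x y′ a
  gadgetProfile-unless-bob x y y′ a ≢bob = cong (λ f → ranking (f ∘ to) a) (level-unless-bob (to a) ≢bob)

  gadgetProfile-unless-alice : ∀ x x′ y a → (∀ i → to a ≢ alice i) → gadgetProfile x y a ≡ gadgetProfile x′ y a
  gadgetProfile-unless-alice x x′ y a ≢alice = cong (λ f → ranking (f ∘ to) a) (level-unless-alice (to a) ≢alice)

  module _ (from : Role m r → Fin n) (to-from : ∀ p → to (from p) ≡ p) (from-to : ∀ a → from (to a) ≡ a)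
           (x y : Fin m → Fin m → Bool) where
    open Gadget {m} {r} x y hiding (level)

    private
      level′ : Role m r → Role m r → ℕ
      level′ = level x y

    disjoint⇒solvable : (∀ i j → x i j ≡ true → y i j ≡ true → ⊥) → Solvable (gadgetProfile x y)
    disjoint⇒solvable disjoint = M , λ a b (_ , b≢ , a→b , b→a) →
      disjoint-no-block disjoint (to a) (to b)
        (λ eq → b≢ (matched eq))
        (λ eq → b≢ (trans (sym (involutive M b)) (cong (partner M) (sym (matched eq)))))
        (subst (λ s → level′ (to a) (to b) ≤ level′ (to a) s) (to-from (mate (to a))) (before⇒≤ (λ b → level′ (to a) (to b)) a a→b))
        (subst (λ s → level′ (to b) (to a) ≤ level′ (to b) s) (to-from (mate (to b))) (before⇒≤ (λ a → level′ (to b) (to a)) b b→a))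
      where
      M : Matching n
      M .partner a    = from (mate (to a))
      M .no-fixed a e = mate-no-fixed (to a) (trans (sym (to-from (mate (to a)))) (cong to e))
      M .involutive a = trans (cong (from ∘ mate) (to-from (mate (to a)))) (trans (cong from (mate-involutive (to a))) (from-to a))
      matched : ∀ {a b} → to b ≡ mate (to a) → b ≡ partner M a
      matched {a} {b} eq = trans (sym (from-to b)) (cong from eq)

    intersecting⇒unsolvable : ∀ i₀ j₀ → x i₀ j₀ ≡ true → y i₀ j₀ ≡ true →
      (∀ {i j} → x i j ≡ true → y i j ≡ true → i ≡ i₀ × j ≡ j₀) → ¬ Solvable (gadgetProfile x y)
    intersecting⇒unsolvable i₀ j₀ x₀ y₀ only (M , stable) =
      Intersecting.unstable i₀ j₀ x₀ y₀ only π π-involutive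
        (λ p s p≢s p<  s< → stable (from p) (from s)
          ( p≢s ∘ from-injective
          -- If s were already the partner of p, its level would be below itself.
          , (λ eq → ℕ.<-irrefl refl (subst (λ q → level′ p s < level′ p q) (sym (trans (sym (to-from s)) (cong to eq))) p<))
          , prefers (p≢s ∘ sym) p< , prefers p≢s s<))
      where
      π : Role m r → Role m r
      π p = to (partner M (from p))

      π-involutive : ∀ p → π (π p) ≡ p
      π-involutive p = trans (cong (to ∘ partner M) (from-to _)) (trans (cong to (involutive M (from p))) (to-from p))

      from-injective : ∀ {p s} → from p ≡ from s → p ≡ s
      from-injective {p} {s} eq = trans (sym (to-from p)) (trans (cong to eq) (to-from s))

      prefers : ∀ {p s} → s ≢ p → level′ p s < level′ p (π p) → Prefers (gadgetProfile x y) (from p) (from s) (partner M (from p))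
      prefers {p} {s} s≢p lt = <⇒before _ (from p) (s≢p ∘ from-injective) (no-fixed M (from p))
        (subst₂ (λ p′ s′ → level′ p′ s′ < level′ p′ (π p)) (sym (to-from p)) (sym (to-from s)) lt)

-- Enumerations of agents and roles.

lookup-injective : ∀ {A : Set} {xs : List A} → Unique xs → ∀ i j → lookup xs i ≡ lookup xs j → i ≡ j
lookup-injective (_ ∷ _)  zero    zero    _  = refl
lookup-injective (p ∷ _)  zero    (suc j) eq = contradiction eq (All.lookup p (∈-lookup j))
lookup-injective (p ∷ _)  (suc i) zero    eq = contradiction (sym eq) (All.lookup p (∈-lookup i))
lookup-injective (_ ∷ ps) (suc i) (suc j) eq = cong suc (lookup-injective ps i j eq)

lookup-++-left : ∀ {A : Set} {P : A → Set} (xs ys : List A) → All P xs → ∀ k → toℕ k < length xs → P (lookup (xs ++ ys) k)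
lookup-++-left (_ ∷ _)  ys (p ∷ _)  zero    _        = p
lookup-++-left (_ ∷ xs) ys (_ ∷ ps) (suc k) (s≤s lt) = lookup-++-left xs ys ps k lt

lookup-++-right : ∀ {A : Set} {P : A → Set} (xs ys : List A) → All P ys → ∀ k → length xs ≤ toℕ k → P (lookup (xs ++ ys) k)
lookup-++-right []       ys ps k       _        = All.lookup ps (∈-lookup k)
lookup-++-right (_ ∷ xs) ys ps (suc k) (s≤s le) = lookup-++-right xs ys ps k le

length-filter-¬ : ∀ {A : Set} {P : A → Set} (P? : Decidable P) xs →
                  length (filter P? xs) + length (filter (¬? ∘ P?) xs) ≡ length xs
length-filter-¬ P? []       = refl
length-filter-¬ P? (x ∷ xs) with P? x
... | yes _ = cong suc (length-filter-¬ P? xs)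
... | no  _ = trans (ℕ.+-suc _ _) (cong suc (length-filter-¬ P? xs))

length-filter-∪ : ∀ {A : Set} {P Q S : A → Set} (P? : Decidable P) (Q? : Decidable Q) (S? : Decidable S) →
  (∀ a → P a → Q a ⊎ S a) → ∀ xs → length (filter P? xs) ≤ length (filter Q? xs) + length (filter S? xs)
length-filter-∪ P? Q? S? P⊆Q∪S []       = z≤n
length-filter-∪ P? Q? S? P⊆Q∪S (a ∷ xs) with P? a | Q? a | S? a | length-filter-∪ P? Q? S? P⊆Q∪S xs
... | yes _ | yes _ | yes _ | ih = s≤s (ℕ.≤-trans ih (ℕ.+-monoʳ-≤ (length (filter Q? xs)) (ℕ.n≤1+n _)))
... | yes _ | yes _ | no  _ | ih = s≤s ih
... | yes _ | no  _ | yes _ | ih = ℕ.≤-trans (s≤s ih) (ℕ.≤-reflexive (sym (ℕ.+-suc _ _)))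
... | yes p | no ¬q | no ¬s | ih = contradiction (P⊆Q∪S a p) [ ¬q , ¬s ]′
... | no  _ | yes _ | yes _ | ih = ℕ.m≤n⇒m≤1+n (ℕ.≤-trans ih (ℕ.+-monoʳ-≤ (length (filter Q? xs)) (ℕ.n≤1+n _)))
... | no  _ | yes _ | no  _ | ih = ℕ.m≤n⇒m≤1+n ih
... | no  _ | no  _ | yes _ | ih = ℕ.≤-trans ih (ℕ.+-monoʳ-≤ (length (filter Q? xs)) (ℕ.n≤1+n _))
... | no  _ | no  _ | no  _ | ih = ih

-- A permutation of the agents that puts those satisfying P first, so that the side of an agent can
-- be read from its index.
module Arrangement {n : ℕ} {P : Fin n → Set} (P? : Decidable P) where

  inside outside agents : List (Fin n)
  inside  = filter P? (allFin n)
  outside = filter (¬? ∘ P?) (allFin n)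
  agents  = inside ++ outside

  length-parts : length inside + length outside ≡ n
  length-parts = trans (length-filter-¬ P? (allFin n)) (length-tabulate {n = n} (λ i → i))

  length-agents : length agents ≡ n
  length-agents = trans (length-++ inside) length-parts

  agents-unique : Unique agents
  agents-unique = Unique.++⁺ (Unique.filter⁺ P? (Unique.allFin⁺ n)) (Unique.filter⁺ (¬? ∘ P?) (Unique.allFin⁺ n))
    (λ (a∈ , a∈′) → proj₂ (∈-filter⁻ (¬? ∘ P?) {xs = allFin n} a∈′) (proj₂ (∈-filter⁻ P? {xs = allFin n} a∈)))

  ∈-agents : ∀ a → a ∈ agents
  ∈-agents a with P? a
  ... | yes p = ∈-++⁺ˡ (∈-filter⁺ P? (∈-allFin a) p)
  ... | no ¬p = ∈-++⁺ʳ inside (∈-filter⁺ (¬? ∘ P?) (∈-allFin a) ¬p)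

  agentAt : Fin n → Fin n
  agentAt k = lookup agents (cast (sym length-agents) k)

  indexOf : Fin n → Fin n
  indexOf a = cast length-agents (index (∈-agents a))

  agentAt-indexOf : ∀ a → agentAt (indexOf a) ≡ a
  agentAt-indexOf a = trans (cong (lookup agents) (Fin.cast-involutive (sym length-agents) length-agents _))
    (sym (lookup-index (∈-agents a)))

  indexOf-agentAt : ∀ k → indexOf (agentAt k) ≡ k
  indexOf-agentAt k = trans
    (cong (cast length-agents) (lookup-injective agents-unique _ _ (sym (lookup-index (∈-agents (agentAt k))))))
    (Fin.cast-involutive length-agents (sym length-agents) k)

  agentAt-inside : ∀ k → toℕ k < length inside → P (agentAt k)
  agentAt-inside k lt = lookup-++-left inside outside (All.all-filter P? (allFin n)) _
    (subst (_< length inside) (sym (Fin.toℕ-cast (sym length-agents) k)) lt)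

  agentAt-outside : ∀ k → length inside ≤ toℕ k → ¬ P (agentAt k)
  agentAt-outside k le = lookup-++-right inside outside (All.all-filter (¬? ∘ P?) (allFin n)) _
    (subst (length inside ≤_) (sym (Fin.toℕ-cast (sym length-agents) k)) le)

rows : ℕ → ℕ → ℕ
rows m r = m + (suc r + m)

module _ {m r : ℕ} where

  private
    h : ℕ
    h = rows m r

  row : Fin h → Row m r
  row = Sum.map₂ (splitAt (suc r)) ∘ splitAt m

  rowIndex : Row m r → Fin h
  rowIndex = join m (suc r + m) ∘ Sum.map₂ (join (suc r) m)

  row-rowIndex : ∀ w → row (rowIndex w) ≡ w
  row-rowIndex w rewrite Fin.splitAt-join m (suc r + m) (Sum.map₂ (join (suc r) m) w) with w
  ... | inj₁ _ = refl
  ... | inj₂ v = cong inj₂ (Fin.splitAt-join (suc r) m v)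

  rowIndex-row : ∀ k → rowIndex (row k) ≡ k
  rowIndex-row k = trans (cong (join m (suc r + m)) (undo (splitAt m k))) (Fin.join-splitAt m (suc r + m) k)
    where
    undo : ∀ s → Sum.map₂ (join (suc r) m) (Sum.map₂ (splitAt (suc r)) s) ≡ s
    undo (inj₁ _) = refl
    undo (inj₂ v) = cong inj₂ (Fin.join-splitAt (suc r) m v)

  roleAt : Fin (h + h) → Role m r
  roleAt k = [ (λ w → row w , false) , (λ w → row w , true) ]′ (splitAt h k)

  roleIndex : Role m r → Fin (h + h)
  roleIndex (w , false) = rowIndex w ↑ˡ h
  roleIndex (w , true)  = h ↑ʳ rowIndex w

  roleAt-roleIndex : ∀ p → roleAt (roleIndex p) ≡ p
  roleAt-roleIndex (w , false) rewrite Fin.splitAt-↑ˡ h (rowIndex w) h = cong (_, false) (row-rowIndex w)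
  roleAt-roleIndex (w , true)  rewrite Fin.splitAt-↑ʳ h h (rowIndex w) = cong (_, true) (row-rowIndex w)

  roleIndex-roleAt : ∀ k → roleIndex (roleAt k) ≡ k
  roleIndex-roleAt k = trans (undo (splitAt h k)) (Fin.join-splitAt h h k)
    where
    undo : ∀ s → roleIndex ([ (λ w → row w , false) , (λ w → row w , true) ]′ s) ≡ join h h s
    undo (inj₁ w) = cong (_↑ˡ h) (rowIndex-row w)
    undo (inj₂ w) = cong (h ↑ʳ_) (rowIndex-row w)

  alice-index : ∀ i → toℕ (roleIndex (alice i)) < m
  alice-index i = subst (_< m) (sym (trans (Fin.toℕ-↑ˡ (i ↑ˡ (suc r + m)) h) (Fin.toℕ-↑ˡ i (suc r + m)))) (Fin.toℕ<n i)

  bob-index : ∀ j → h + (m + suc r) ≤ toℕ (roleIndex (bob j))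
  bob-index j = subst (h + (m + suc r) ≤_) (sym (trans (Fin.toℕ-↑ʳ h (m ↑ʳ (suc r ↑ʳ j)))
    (cong (h +_) (trans (Fin.toℕ-↑ʳ m (suc r ↑ʳ j)) (cong (m +_) (Fin.toℕ-↑ʳ (suc r) j))))))
    (ℕ.+-monoʳ-≤ h (ℕ.+-monoʳ-≤ m (ℕ.m≤m+n (suc r) (toℕ j))))

-- A balanced threshold on the batches.

module _ {n k : ℕ} (batch : Fin n → Fin k) where

  Early : ℕ → Fin n → Set
  Early t a = toℕ (batch a) < t

  early? : ∀ t → Decidable (Early t)
  early? t a = toℕ (batch a) <? t

  earlyCount : ℕ → ℕ
  earlyCount t = length (filter (early? t) (allFin n))

  earlyCount-zero : earlyCount 0 ≡ 0
  earlyCount-zero = cong length (filter-none (early? 0) (All.universal (λ _ ()) (allFin n)))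

  earlyCount-all : earlyCount k ≡ n
  earlyCount-all = trans (cong length (filter-all (early? k) (All.universal (λ a → Fin.toℕ<n (batch a)) (allFin n)))) (length-tabulate {n = n} (λ i → i))

  earlyCount-suc : ∀ i → earlyCount (suc (toℕ i)) ≤ earlyCount (toℕ i) + BatchSize batch i
  earlyCount-suc i = length-filter-∪ (early? (suc (toℕ i))) (early? (toℕ i)) (λ a → batch a Fin.≟ i) split (allFin n)
    where
    split : ∀ a → Early (suc (toℕ i)) a → Early (toℕ i) a ⊎ batch a ≡ i
    split a (s≤s le) = Sum.map₂ Fin.toℕ-injective (ℕ.m≤n⇒m<n∨m≡n le)

  -- The threshold descends from k while at least n/4 agents stay early. At the last such value, one
  -- batch fewer leaves under n/4, and a batch adds at most n/2.
  balanced-threshold : SmallBatches batch → ∃ λ t → n ≤ 4 * earlyCount t × 4 * earlyCount t ≤ 3 * n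
  balanced-threshold small = search k ℕ.≤-refl (ℕ.≤-trans (ℕ.≤-reflexive (sym earlyCount-all)) (ℕ.m≤n*m (earlyCount k) 4))
    where
    search : ∀ t → t ≤ k → n ≤ 4 * earlyCount t → ∃ λ t → n ≤ 4 * earlyCount t × 4 * earlyCount t ≤ 3 * n
    -- No agent is early at threshold 0, so the upper bound is trivial.
    search zero    _   le = zero , le , subst (λ c → 4 * c ≤ 3 * n) (sym earlyCount-zero) z≤n
    search (suc t) t<k le with n ≤? 4 * earlyCount t
    ... | yes le′ = search t (ℕ.<⇒≤ t<k) le′
    ... | no  gt  = suc t , le , (begin
      4 * earlyCount (suc t)                         ≡⟨ cong (λ s → 4 * earlyCount (suc s)) (sym t≡) ⟩
      4 * earlyCount (suc (toℕ i))                   ≤⟨ ℕ.*-monoʳ-≤ 4 (earlyCount-suc i) ⟩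
      4 * (earlyCount (toℕ i) + BatchSize batch i)   ≡⟨ ℕ.*-distribˡ-+ 4 (earlyCount (toℕ i)) (BatchSize batch i) ⟩
      4 * earlyCount (toℕ i) + 4 * BatchSize batch i ≡⟨ cong₂ _+_ (cong (λ s → 4 * earlyCount s) t≡) (ℕ.*-assoc 2 2 (BatchSize batch i)) ⟩
      4 * earlyCount t + 2 * (2 * BatchSize batch i) ≤⟨ ℕ.+-mono-≤ (ℕ.<⇒≤ (ℕ.≰⇒> gt)) (ℕ.*-monoʳ-≤ 2 (small i)) ⟩
      n + 2 * n ∎)
      where
      open ℕ.≤-Reasoning
      i = Fin.fromℕ< t<k
      t≡ : toℕ i ≡ t
      t≡ = Fin.toℕ-fromℕ< t<k

-- Search over the finite sample space.

anyVec? : ∀ {N} {P : Vec Bool N → Set} → Decidable P → Dec (∃ P)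
anyVec? {zero}  P? = map′ ([] ,_) (λ { ([] , p) → p }) (P? [])
anyVec? {suc N} P? = map′
  [ (λ (v , p) → false ∷ v , p) , (λ (v , p) → true ∷ v , p) ]′
  (λ { (false ∷ v , p) → inj₁ (v , p) ; (true ∷ v , p) → inj₂ (v , p) })
  (anyVec? (λ v → P? (false ∷ v)) ⊎-dec anyVec? (λ v → P? (true ∷ v)))

-- Turns the refutation that all samples are cheap into an explicit expensive profile.
anySample? : ∀ {N} {P : Samples N → Set} → Decidable P → Dec (∃ P)
anySample? P? = map′
  (λ (i , D , z , z′ , p) → (i , D , z , z′) , p)
  (λ ((i , D , z , z′) , p) → i , D , z , z′ , p)
  (Fin.any? λ i → anyVec? λ D → anyVec? λ z → anyVec? λ z′ → P? (i , D , z , z′))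

-- Intersections of planted instances.

module _ {N : ℕ} where

  -- Away from the planted coordinate the masks D and `∁ D` leave a bit to at most one player.
  exclusive-off : ∀ c (ω : Samples N) l → l ≢ proj₁ ω →
    Vec.lookup (proj₁ (instance-at c ω)) l ≡ true → Vec.lookup (proj₂ (instance-at c ω)) l ≡ true → ⊥
  exclusive-off c (i , D , z , z′) l l≢i xₗ yₗ = exclusive (Vec.lookup D l)
    (trans (sym (lookup-zipWith _∧_ l D z)) (trans (sym (lookup∘update′ l≢i (D ∧ᵛ z) c)) xₗ))
    (trans (sym (trans (lookup-zipWith _∧_ l (∁ D) z′) (cong (_∧ Vec.lookup z′ l) (lookup-map l not D))))
           (trans (sym (lookup∘update′ l≢i (∁ D ∧ᵛ z′) c)) yₗ))
    where
    exclusive : ∀ d {b b′} → d ∧ b ≡ true → not d ∧ b′ ≡ true → ⊥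
    exclusive true  _ ()
    exclusive false () _

  disjoint-instance : ∀ (ω : Samples N) l →
    Vec.lookup (proj₁ (instance-at false ω)) l ≡ true → Vec.lookup (proj₂ (instance-at false ω)) l ≡ true → ⊥
  disjoint-instance ω@(i , D , z , z′) l xₗ yₗ with l Fin.≟ i
  ... | no  l≢i  = exclusive-off false ω l l≢i xₗ yₗ
  ... | yes refl = contradiction (trans (sym (lookup∘update i (D ∧ᵛ z) false)) xₗ) λ ()

  intersecting-instance : ∀ (ω : Samples N) l →
    Vec.lookup (proj₁ (instance-at true ω)) l ≡ true → Vec.lookup (proj₂ (instance-at true ω)) l ≡ true → l ≡ proj₁ ω
  intersecting-instance ω@(i , _) l xₗ yₗ with l Fin.≟ i
  ... | yes l≡i = l≡i
  ... | no  l≢i = ⊥-elim (exclusive-off true ω l l≢i xₗ yₗ)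

-- Reduction from disjointness to solvability.

bit : ∀ {m} → Vec Bool (m * m) → Fin m → Fin m → Bool
bit x i j = Vec.lookup x (combine i j)

module _ {m r k : ℕ} (batch : Fin (rows m r + rows m r) → Fin k)
         (R : Randomized (rows m r + rows m r)) (allowed : AllowedRandomized batch R) (decides : DecidesSolvability R)
         (t : ℕ) (many : rows m r + rows m r ≤ 4 * earlyCount batch t)
         (few : 4 * earlyCount batch t ≤ 3 * (rows m r + rows m r)) where

  private
    h n : ℕ
    h = rows m r
    n = h + h

    open Arrangement (early? batch t)

    to : Fin n → Role m r
    to = roleAt ∘ indexOf

    from : Role m r → Fin n
    from = agentAt ∘ roleIndex

    to-from : ∀ p → to (from p) ≡ p
    to-from p = trans (cong roleAt (indexOf-agentAt (roleIndex p))) (roleAt-roleIndex p)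

    from-to : ∀ a → from (to a) ≡ a
    from-to a = trans (cong agentAt (roleIndex-roleAt {m} {r} (indexOf a))) (agentAt-indexOf a)

    4m≤n : 4 * m ≤ n
    4m≤n = subst (4 * m ≤_)
      (solve 2 (λ m r → con 4 :* m :+ (con 2 :+ con 2 :* r) := (m :+ (con 1 :+ r :+ m)) :+ (m :+ (con 1 :+ r :+ m))) refl m r)
      (ℕ.m≤m+n (4 * m) (2 + 2 * r))
      where open ℕ-Solver

    alice-early : ∀ i → Early batch t (from (alice i))
    alice-early i = agentAt-inside (roleIndex (alice i)) (ℕ.<-≤-trans (alice-index i)
      (ℕ.*-cancelˡ-≤ 4 (ℕ.≤-trans 4m≤n many)))

    -- At most 3n/4 agents are early, and the bobs occupy the last m indices, where m is at most
    -- n/4.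
    bob-late : ∀ j → ¬ Early batch t (from (bob j))
    bob-late j = agentAt-outside (roleIndex (bob j)) (ℕ.≤-trans (ℕ.*-cancelˡ-≤ 4 (ℕ.+-cancelʳ-≤ (4 * m) _ _ (begin
      4 * length inside + 4 * m  ≤⟨ ℕ.+-mono-≤ few 4m≤n ⟩
      3 * n + n                  ≡⟨ solve 2 (λ m r → let h = m :+ (con 1 :+ r :+ m) in
                                      con 3 :* (h :+ h) :+ (h :+ h) := con 4 :* (h :+ (m :+ (con 1 :+ r))) :+ con 4 :* m) refl m r ⟩
      4 * (h + (m + suc r)) + 4 * m ∎))) (bob-index j))
      where
      open ℕ-Solver
      open ℕ.≤-Reasoning

    encode : Inputs (m * m) → Profile n
    encode (x , y) = gadgetProfile to (bit x) (bit y)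

    valid : ∀ xy → ValidProfile (encode xy)
    valid (x , y) = gadgetProfile-valid to (bit x) (bit y)

    -- A batch lies on one side of the threshold. An early batch holds no bob and cannot see y; a
    -- late batch holds no alice and cannot see x.
    local : ∀ {q} → AllowedQuery batch q → Local encode q
    local {q} (i , only-i) = [ earlyQuery , lateQuery ]′ (Dec.toSum (toℕ i <? t))
      where
      earlyQuery : toℕ i < t → Local encode q
      earlyQuery early = inj₁ λ x y y′ → only-i (encode (x , y)) (encode (x , y′)) (valid (x , y)) (valid (x , y′)) λ { a refl →
          gadgetProfile-unless-bob to (bit x) (bit y) (bit y′) a (λ j eq →
            bob-late j (subst (Early batch t) (trans (sym (from-to a)) (cong from eq)) early)) }
      lateQuery : ¬ (toℕ i < t) → Local encode q
      lateQuery late = inj₂ λ x x′ y → only-i (encode (x , y)) (encode (x′ , y)) (valid (x , y)) (valid (x′ , y)) λ { a refl →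
          gadgetProfile-unless-alice to (bit x) (bit x′) (bit y) a (λ j eq →
            late (subst (Early batch t) (trans (cong from (sym eq)) (from-to a)) (alice-early j))) }

    accepts : ∀ ω → ⅔ ℚ.≤ probOutput R (encode (instance-at false ω)) true
    accepts ω = decides _ (valid (instance-at false ω)) true (mk⇔
      (λ _ → disjoint⇒solvable to from to-from from-to _ _ (λ i j → disjoint-instance ω (combine i j)))
      (λ _ → refl))

    rejects : ∀ ω → ⅔ ℚ.≤ probOutput R (encode (instance-at true ω)) false
    rejects ω@(l , D , z , z′) = decides _ (valid (instance-at true ω)) false (mk⇔ (λ ())
      (λ solvable → ⊥-elim (intersecting⇒unsolvable to from to-from from-to _ _ i₀ j₀
        (trans (cong (Vec.lookup (proj₁ (instance-at true ω))) l≡) (lookup∘update l (D ∧ᵛ z) true))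
        (trans (cong (Vec.lookup (proj₂ (instance-at true ω))) l≡) (lookup∘update l (∁ D ∧ᵛ z′) true))
        (λ {i} {j} xᵢⱼ yᵢⱼ → Fin.combine-injective i j i₀ j₀ (trans (intersecting-instance ω (combine i j) xᵢⱼ yᵢⱼ) (sym l≡)))
        solvable)))
      where
      -- The planted coordinate, read back as a matrix position.
      i₀ = proj₁ (remQuot {m} m l)
      j₀ = proj₂ (remQuot {m} m l)
      l≡ : combine i₀ j₀ ≡ l
      l≡ = Fin.combine-remQuot {m} m l

  -- If the search fails, all disjoint instances cost less than C, contradicting `expensive`. So the
  -- hard profile is a solvable one.
  expensive-profile : ∀ Q′ C → m * m ≡ 40 * (10 * (16 * suc Q′)) → C ℚ.≤ ι (suc Q′) ℚ.* 1/30 →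
    Σ (Profile n) λ P → ValidProfile P × C ℚ.≤ expectedCost R P
  expensive-profile Q′ C m²≡ C≤ = [ found , ⊥-elim ∘ none ]′ (Dec.toSum (anySample? (λ ω → C ℚ.≤? costAt ω)))
    where
    costAt : Samples (m * m) → ℚ
    costAt ω = expectedCost R (encode (instance-at false ω))

    found : (∃ λ ω → C ℚ.≤ costAt ω) → Σ (Profile n) λ P → ValidProfile P × C ℚ.≤ expectedCost R P
    found (ω , C≤cost) = encode (instance-at false ω) , valid (instance-at false ω) , C≤cost

    none : ¬ (∃ λ ω → C ℚ.≤ costAt ω) → ⊥
    none ¬expensive = expensive encode local R allowed accepts rejects Q′ m²≡
      (λ ω → ℚ.≤-trans (ℚ.<⇒≤ (ℚ.≰⇒> (λ C≤cost → ¬expensive (ω , C≤cost)))) C≤)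

open import Data.Integer using (+_)

-- Choice of the parameters.

c : ℚ
c = + 1 ℚ./ 19200000

square : ∀ a q → (a * q) * (a * q) ≡ a * (a * (q * q))
square = solve 2 (λ a q → (a :* q) :* (a :* q) := a :* (a :* (q :* q))) refl
  where open ℕ-Solver

-- 19200000 = 30 · 800².
quadratic : ∀ n q → n ≤ 800 * q → c ℚ.* (+ (n * n) ℚ./ 1) ℚ.≤ ι (q * q) ℚ.* 1/30
quadratic n q n≤800q = begin
  c ℚ.* (+ (n * n) ℚ./ 1)            ≡⟨ cong (c ℚ.*_) (sym (ι≡/1 (n * n))) ⟩
  c ℚ.* ι (n * n)                    ≤⟨ *-monoˡ-≤ (ℚ.nonNegative⁻¹ c) (ι-mono (ℕ.≤-trans (ℕ.*-mono-≤ n≤800q n≤800q) (ℕ.≤-reflexive (square 800 q)))) ⟩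
  c ℚ.* ι (800 * (800 * (q * q)))    ≡⟨ cong (c ℚ.*_) (trans (ι-* 800 (800 * (q * q))) (cong (ι 800 ℚ.*_) (ι-* 800 (q * q)))) ⟩
  c ℚ.* (ι 800 ℚ.* (ι 800 ℚ.* w))    ≡⟨ cong (λ p → c ℚ.* (p ℚ.* (p ℚ.* w))) (ι≡/1 800) ⟩
  c ℚ.* (800ℚ ℚ.* (800ℚ ℚ.* w))      ≡⟨ solve 1 (λ w → con c :* (con 800ℚ :* (con 800ℚ :* w)) := w :* con 1/30) refl w ⟩
  w ℚ.* 1/30                         ∎
  where
  open ℚ.≤-Reasoning
  open ℚ-Solver using (solve; con; _:*_; _:=_)
  w = ι (q * q)
  800ℚ = + 800 ℚ./ 1

-- The gadget occupies 2m + 1 rows of two agents each, counting the hub row; all further rows become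
-- padding.
halve : ∀ n m → 2 ∣ n → 4 * m + 2 ≤ n → ∃ λ r → n ≡ rows m r + rows m r
halve n m (divides h n≡h*2) 4m+2≤n = r , trans n≡h*2 (trans (cong (_* 2) (sym (ℕ.m+[n∸m]≡n 2m+1≤h)))
    (solve 2 (λ m r → (con 2 :* m :+ con 1 :+ r) :* con 2 := (m :+ (con 1 :+ r :+ m)) :+ (m :+ (con 1 :+ r :+ m))) refl m r))
  where
  open ℕ-Solver
  r = h ∸ (2 * m + 1)
  2m+1≤h : 2 * m + 1 ≤ h
  2m+1≤h = ℕ.*-cancelʳ-≤ (2 * m + 1) h 2 (subst₂ _≤_
    (solve 1 (λ m → con 4 :* m :+ con 2 := (con 2 :* m :+ con 1) :* con 2) refl m) n≡h*2 4m+2≤n)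

lower-bound : ∀ {n m r k} → n ≡ rows m r + rows m r →
  (batch : Fin n → Fin k) → SmallBatches batch →
  (R : Randomized n) → AllowedRandomized batch R → DecidesSolvability R →
  ∀ Q′ C → m * m ≡ 40 * (10 * (16 * suc Q′)) → C ℚ.≤ ι (suc Q′) ℚ.* 1/30 →
  Σ (Profile n) λ P → ValidProfile P × C ℚ.≤ expectedCost R P
lower-bound {m = m} {r} refl batch small R allowed decides =
  let t , many , few = balanced-threshold batch small
  in expensive-profile {m} {r} batch R allowed decides t many few

side-squared : ∀ q → (80 * q) * (80 * q) ≡ 40 * (10 * (16 * (q * q)))
side-squared q = trans (square 80 q) (trans (sym (ℕ.*-assoc 80 80 (q * q)))
  (trans (ℕ.*-assoc 40 160 (q * q)) (cong (40 *_) (ℕ.*-assoc 10 16 (q * q)))))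

-- Take q to be n / 400 rounded down, which is positive. Then 320 q + 2 is at most 400 q, hence at
-- most n, and the remainder below 400 is at most 400 q.
scale : ∀ n → 400 ≤ n → ∃ λ q′ → 4 * (80 * suc q′) + 2 ≤ n × n ≤ 800 * suc q′
scale n 400≤n = q′ ,
  (begin
    4 * (80 * q) + 2       ≤⟨ ℕ.+-monoʳ-≤ (4 * (80 * q)) (ℕ.≤-trans (s≤s (s≤s z≤n)) (ℕ.m≤m*n 80 q)) ⟩
    4 * (80 * q) + 80 * q  ≡⟨ cong (λ p → p + 80 * q) (sym (ℕ.*-assoc 4 80 q)) ⟩
    320 * q + 80 * q       ≡⟨ sym (ℕ.*-distribʳ-+ q 320 80) ⟩
    400 * q                ≡⟨ ℕ.*-comm 400 q ⟩
    q * 400                ≡⟨ cong (_* 400) q≡ ⟩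
    n ℕ./ 400 * 400        ≤⟨ m/n*n≤m n 400 ⟩
    n                      ∎) ,
  (begin
    n                            ≡⟨ m≡m%n+[m/n]*n n 400 ⟩
    n ℕ.% 400 + n ℕ./ 400 * 400  ≤⟨ ℕ.+-mono-≤ (ℕ.<⇒≤ (m%n<n n 400)) (ℕ.≤-reflexive (cong (_* 400) (sym q≡))) ⟩
    400 + q * 400                ≤⟨ ℕ.+-monoˡ-≤ (q * 400) (ℕ.m≤m*n 400 q) ⟩
    400 * q + q * 400            ≡⟨ cong (λ p → 400 * q + p) (ℕ.*-comm q 400) ⟩
    400 * q + 400 * q            ≡⟨ sym (ℕ.*-distribʳ-+ q 400 400) ⟩
    800 * q                      ∎)
  where
  open ℕ.≤-Reasoning
  q′ = ℕ.pred (n ℕ./ 400)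
  q = suc q′
  q≡ : q ≡ n ℕ./ 400
  q≡ = ℕ.suc-pred (n ℕ./ 400) {{ℕ.>-nonZero (m≥n⇒m/n>0 400≤n)}}

theorem4 : Σ ℚ λ c → (0ℚ ℚ.< c) × Σ ℕ λ n₀ →
    ∀ (n : ℕ) → n₀ ≤ n → 2 ∣ n →
    ∀ (k : ℕ) (batch : Fin n → Fin k) → SmallBatches batch →
    ∀ (R : Randomized n) → AllowedRandomized batch R → DecidesSolvability R →
    Σ (Profile n) λ P → ValidProfile P ×
    (c ℚ.* ((+ (n * n)) ℚ./ 1) ℚ.≤ expectedCost R P)
theorem4 = c , ℚ.positive⁻¹ c , 400 , λ n 400≤n even k batch small R allowed decides →
  let q′ , room , n≤800q = scale n 400≤n
      r , n≡            = halve n (80 * suc q′) even room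
  -- The argument is chosen so that its successor computes to q², where q is `suc q′`. Thus Q = q²,
  -- and the side m = 80 q gives N = m² = 6400 Q.
  in lower-bound n≡ batch small R allowed decides (q′ + q′ * suc q′) (c ℚ.* (+ (n * n) ℚ./ 1))
       (side-squared (suc q′)) (quadratic n (suc q′) n≤800q)
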